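{- Let $w\in c_1$ have (unique) reduced expression $w=s_1s_2\cdots s_n$ with $\{s_1,s_2,s_3\}=S$, and let $u\in(c_0)^w_3$. Then $\mu(u,w)\neq0$ if and only if $|L(u)|=|R(u)|=2$, $s_1\in L(u)$, $s_n\in R(u)$, $s_2\notin L(u)$ and $s_{n-1}\notin R(u)$. Moreover, in that case $\mu(u,w)=1$.
   Context: $W$ is the affine Weyl group of type $\widetilde A_2$: the Coxeter group on $S=\{r,s,t\}$ with $(rs)^3=(st)^3=(rt)^3=1$, with length $l$ and Bruhat order $\le$. For $u<w$, $\mu(u,w)$ is the coefficient of $q^{(l(w)-l(u)-1)/2}$ in the Kazhdan–Lusztig polynomial $P_{u,w}$. $c_1$ is the set of elements $w\neq e$ having a unique reduced expression (the two-sided cell of $\mathbf a$-value 1), and $c_0=W\setminus(\{e\}\cup c_1)$ (the two-sided cell of $\mathbf a$-value 3). For $w\in W$, $L(w)=\{\sigma\in S:\sigma w<w\}$, $R(w)=\{\sigma\in S: w\sigma<w\}$, and $(c_0)^w_3=\{u\in c_0: u<w,\ l(w)-l(u)=3\}$. -}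

module Defs where

open import Data.Bool using (Bool; true; false; if_then_else_)
open import Data.Fin using (Fin)
open import Data.List using (List; []; _∷_; _++_; length; foldr; map)
open import Data.List.Relation.Binary.Sublist.Propositional using (_⊆_)
open import Data.List.Relation.Unary.All using (All)
open import Data.List.Relation.Unary.Any using (Any)
open import Data.List.Relation.Unary.AllPairs using (AllPairs)
open import Data.Nat using (ℕ; zero; suc; _∸_; _≤_; ⌊_/2⌋)
open import Data.Integer using (ℤ; _+_; _-_; _*_; 0ℤ; 1ℤ)
open import Data.Product using (Σ; _×_; ∃)
open import Relation.Binary.PropositionalEquality using (_≡_; _≢_)
open import Relation.Binary.Construct.Closure.Equivalence using (EqClosure)
open import Relation.Nullary using (¬_)

-- The Coxeter group W of type Ã₂, by its Coxeter presentation.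
-- Generators S = {r,s,t} = Fin 3; an element is represented by a word,
-- and two words represent the same element iff they are related by the
-- equivalence (and congruence) closure of the defining relations
--   σσ = 1  and  στσ = τστ  (σ ≠ τ; all m(σ,τ) = 3).

S : Set
S = Fin 3

Word : Set
Word = List S

data _⟶_ : Word → Word → Set where
  cancel : ∀ (σ : S) (p q : Word) → (p ++ σ ∷ σ ∷ q) ⟶ (p ++ q)
  braid  : ∀ (σ τ : S) → σ ≢ τ → ∀ (p q : Word) →
           (p ++ σ ∷ τ ∷ σ ∷ q) ⟶ (p ++ τ ∷ σ ∷ τ ∷ q)

_≈_ : Word → Word → Set
_≈_ = EqClosure _⟶_

-- reduced expressions; for a reduced word, l(w) = length w
Reduced : Word → Set
Reduced w = ∀ w' → w' ≈ w → length w ≤ length w'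

-- Bruhat order (subword characterisation): u ≤ w iff u equals a subword
-- of some reduced expression of w.
_≤B_ : Word → Word → Set
u ≤B w = Σ Word λ w' → Reduced w' × w' ≈ w × (Σ Word λ v → v ⊆ w' × v ≈ u)

_<B_ : Word → Word → Set
u <B w = u ≤B w × ¬ (u ≈ w)

InC1 : Word → Set
InC1 w = Reduced w × ¬ (w ≈ []) × (∀ w' → Reduced w' → w' ≈ w → w' ≡ w)

InC0 : Word → Set
InC0 u = Reduced u × ¬ (u ≈ []) × ¬ InC1 u

InC0w3 : Word → Word → Set
InC0w3 w u = InC0 u × u <B w × length w ≡ length u Data.Nat.+ 3

InL : Word → S → Set
InL u σ = (σ ∷ u) <B u

InR : Word → S → Set
InR u σ = (u ++ σ ∷ []) <B u

HasCard2 : (S → Set) → Set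
HasCard2 A = Σ S λ a → Σ S λ b → a ≢ b × A a × A b × (∀ c → A c → c ≡ a Data.Sum.⊎ c ≡ b)
  where import Data.Sum

-- Kazhdan–Lusztig polynomials.  A polynomial in ℤ[q] is represented by
-- its coefficient function ℕ → ℤ;  P x w k = coefficient of q^k in P_{x,w}.

KLFamily : Set
KLFamily = Word → Word → ℕ → ℤ

isOdd : ℕ → Bool
isOdd zero = false
isOdd (suc n) with isOdd n
... | true  = false
... | false = true

μ : KLFamily → Word → Word → ℤ
μ P z v = if isOdd (length v ∸ length z)
          then P z v ⌊ (length v ∸ length z ∸ 1) /2⌋
          else 0ℤ

-- multiplication by q^e on coefficient functions
shift : ℕ → (ℕ → ℤ) → ℕ → ℤ
shift zero f k = f k
shift (suc e) f zero = 0ℤ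
shift (suc e) f (suc k) = shift e f k

sumℤ : List ℤ → ℤ
sumℤ = foldr _+_ 0ℤ

Transversal : (Word → Set) → List Word → Set
Transversal A Z = All A Z × (∀ z → A z → Any (z ≈_) Z) × AllPairs (λ a b → ¬ (a ≈ b)) Z

CorrIdx : S → Word → Word → Set
CorrIdx s v z = Reduced z × z <B v × (s ∷ z) <B z

corr : KLFamily → S → Word → Word → List Word → ℕ → ℤ
corr P s v x Z k =
  sumℤ (map (λ z → μ P z v * shift ⌊ (length (s ∷ v) ∸ length z) /2⌋ (P x z) k) Z)

δe : Word → ℕ → ℤ
δe [] zero = 1ℤ
δe _  _    = 0ℤ

-- P is the family of Kazhdan–Lusztig polynomials of W: it is
-- well defined on elements, P_{x,e} = δ_{x,e}, P_{x,w} = 0 unless x ≤ w,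
-- and it satisfies the Kazhdan–Lusztig recursion (KL79, (2.2.c)):
-- for w = sv > v and x ≤ w,
--   P_{x,w} = q^{1-c} P_{sx,v} + q^c P_{x,v}
--             - Σ_{z<v, sz<z} μ(z,v) q^{(l(w)-l(z))/2} P_{x,z},
-- c = 1 if sx < x, c = 0 otherwise.
record IsKL (P : KLFamily) : Set where
  field
    respects : ∀ x x' w w' → Reduced x → Reduced x' → Reduced w → Reduced w' →
               x ≈ x' → w ≈ w' → ∀ k → P x w k ≡ P x' w' k
    base     : ∀ x → Reduced x → ∀ k → P x [] k ≡ δe x k
    vanish   : ∀ x w → Reduced x → Reduced w → ¬ (x ≤B w) → ∀ k → P x w k ≡ 0ℤ
    step-down : ∀ s v x x' Z → Reduced (s ∷ v) → Reduced x → x ≤B (s ∷ v) →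
                (s ∷ x) <B x → Reduced x' → x' ≈ (s ∷ x) →
                Transversal (CorrIdx s v) Z → ∀ k →
                P x (s ∷ v) k ≡ (P x' v k + shift 1 (P x v) k) - corr P s v x Z k
    step-up   : ∀ s v x x' Z → Reduced (s ∷ v) → Reduced x → x ≤B (s ∷ v) →
                ¬ ((s ∷ x) <B x) → Reduced x' → x' ≈ (s ∷ x) →
                Transversal (CorrIdx s v) Z → ∀ k →
                P x (s ∷ v) k ≡ (shift 1 (P x' v) k + P x v k) - corr P s v x Z k

{-# OPTIONS --safe #-}
module Submission where

-- W acts on the alcoves of the Ã₂ arrangement, and an alcove is given by three integers in which
-- the left descents are the negative coordinates.  Hence two elements a ≠ b of L(x) exclude the
-- third generator from L(a x), and the whole argument consists of lifting along this fact.
--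
-- In colength ≤ 3 the recursion for the coefficient of q in P_{x,sv} only involves constant terms,
-- which are 1 or 0 according to the Bruhat order: μ(x,sv) = 0 if sx > x, and otherwise it is
-- μ(sx,v) + [x ≤ v] - #{z : x ≤ z, z a coatom of v, sz < z}.  An element w of c₁ is a spiral
-- abcabc⋯, so v = bcabca⋯ is one too, and its only coatom with left descent a is z₀ = b·abcabc⋯
-- (the second letter deleted).  So μ(x,w) = μ(ax,v) + [x ≤ v] - [x ≤ z₀].  The first term
-- contributes only if x is a spiral, hence not in c₀, and the other two differ only if x is a
-- coatom of cabcab⋯ with left descent a and is not the spiral abcabc⋯.  This forces x to be cabcab⋯
-- with its penultimate letter deleted, and braid moves, each shifting the defect two places to the
-- left, to rewrite it as a·cabcab⋯.  Conversely, the descents required in the theorem force u to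
-- be this element.

open import Defs
open import Data.Bool using (if_then_else_)
open import Data.Empty using (⊥; ⊥-elim)
open import Data.Fin using (zero; suc; _≟_)
open import Data.Integer as ℤ using (ℤ; +_; -[1+_]; 0ℤ; 1ℤ; -1ℤ; ∣_∣)
import Data.Integer.Properties as ℤ
import Data.Integer.Tactic.RingSolver as ℤSolver
open import Data.List using (List; []; _∷_; _++_; length; map; reverse)
open import Data.List.Membership.Propositional using (_∈_)
open import Data.List.Membership.Propositional.Properties using (∈-++⁺ˡ; ∈-++⁺ʳ; ∈-map⁺)
open import Data.List.Properties using (++-assoc; ++-identityʳ; length-++; length-reverse; reverse-++; reverse-involutive; ∷-injective; ∷ʳ-++)
open import Data.List.Relation.Binary.Sublist.Propositional using (_⊆_; []; _∷_; _∷ʳ_; ⊆-refl; ⊆-trans)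
open import Data.List.Relation.Binary.Sublist.Propositional.Properties using (++⁺; reverse⁺)
open import Data.List.Relation.Unary.All as All using (All; []; _∷_)
open import Data.List.Relation.Unary.All.Properties using (¬Any⇒All¬)
open import Data.List.Relation.Unary.AllPairs using (AllPairs; []; _∷_)
open import Data.List.Relation.Unary.Any as Any using (Any; here; there)
open import Data.Nat as ℕ using (ℕ; zero; suc; pred; _≤_; _<_; z≤n; s≤s; _∸_; ⌊_/2⌋)
import Data.Nat.Properties as ℕ
import Data.Nat.Tactic.RingSolver as ℕSolver
open import Data.Product using (Σ; ∃; _×_; _,_; proj₁; proj₂)
open import Data.Sum as Sum using (_⊎_; inj₁; inj₂)
open import Function.Bundles using (_⇔_; mk⇔)
open import Relation.Binary.Construct.Closure.Equivalence using (gfold; gmap; symmetric)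
open import Relation.Binary.Construct.Closure.ReflexiveTransitive using (ε; _◅◅_; return)
open import Relation.Binary.Construct.Closure.Symmetric using (fwd)
open import Relation.Binary.PropositionalEquality using (_≡_; _≢_; refl; sym; trans; cong; cong₂; subst; subst₂; isEquivalence; module ≡-Reasoning)
open import Relation.Nullary using (¬_; Dec; yes; no; ¬?)
open import Relation.Nullary.Decidable using (map′; _×-dec_)

private variable
  a b c s : S
  u v w x y z : Word


-- Orderings of the three generators

pattern 0F = zero
pattern 1F = suc zero
pattern 2F = suc (suc zero)

-- The six orderings are constructors, so that matching makes all three generators concrete and
-- identities between coordinates hold by computation.
data Tri : S → S → S → Set where
  t012 : Tri 0F 1F 2F
  t120 : Tri 1F 2F 0F
  t201 : Tri 2F 0F 1F
  t021 : Tri 0F 2F 1F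
  t210 : Tri 2F 1F 0F
  t102 : Tri 1F 0F 2F


rotate : Tri a b c → Tri b c a
rotate t012 = t120
rotate t120 = t201
rotate t201 = t012
rotate t021 = t210
rotate t210 = t102
rotate t102 = t021

mirror : Tri a b c → Tri c b a
mirror t012 = t210
mirror t120 = t021
mirror t201 = t102
mirror t021 = t120
mirror t210 = t012
mirror t102 = t201

swap₁₂ : Tri a b c → Tri b a c
swap₁₂ T = mirror (rotate (rotate T))

swap₂₃ : Tri a b c → Tri a c b
swap₂₃ T = mirror (rotate T)

Tri⇒≢ : Tri a b c → a ≢ b
Tri⇒≢ t012 ()
Tri⇒≢ t120 ()
Tri⇒≢ t201 ()
Tri⇒≢ t021 ()
Tri⇒≢ t210 ()
Tri⇒≢ t102 ()

third : ∀ a b → a ≢ b → Σ S (Tri a b)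
third 0F 0F ne = ⊥-elim (ne refl)
third 0F 1F ne = _ , t012
third 0F 2F ne = _ , t021
third 1F 0F ne = _ , t102
third 1F 1F ne = ⊥-elim (ne refl)
third 1F 2F ne = _ , t120
third 2F 0F ne = _ , t201
third 2F 1F ne = _ , t210
third 2F 2F ne = ⊥-elim (ne refl)

Tri-cover : Tri a b c → ∀ σ → σ ≡ a ⊎ σ ≡ b ⊎ σ ≡ c
Tri-cover t012 0F = inj₁ refl
Tri-cover t012 1F = inj₂ (inj₁ refl)
Tri-cover t012 2F = inj₂ (inj₂ refl)
Tri-cover t120 0F = inj₂ (inj₂ refl)
Tri-cover t120 1F = inj₁ refl
Tri-cover t120 2F = inj₂ (inj₁ refl)
Tri-cover t201 0F = inj₂ (inj₁ refl)
Tri-cover t201 1F = inj₂ (inj₂ refl)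
Tri-cover t201 2F = inj₁ refl
Tri-cover t021 0F = inj₁ refl
Tri-cover t021 1F = inj₂ (inj₂ refl)
Tri-cover t021 2F = inj₂ (inj₁ refl)
Tri-cover t210 0F = inj₂ (inj₂ refl)
Tri-cover t210 1F = inj₂ (inj₁ refl)
Tri-cover t210 2F = inj₁ refl
Tri-cover t102 0F = inj₂ (inj₁ refl)
Tri-cover t102 1F = inj₁ refl
Tri-cover t102 2F = inj₂ (inj₂ refl)

-- Alcoves, the action of the generators, descents and length

flip : ℤ → ℤ
flip (+ n)    = -[1+ n ]
flip -[1+ n ] = + n

flip-involutive : ∀ x → flip (flip x) ≡ x
flip-involutive (+ n)    = refl
flip-involutive -[1+ n ] = refl

flip≡ : ∀ x → flip x ≡ -1ℤ ℤ.- x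
flip≡ (+ zero)  = refl
flip≡ (+ suc n) = refl
flip≡ -[1+ n ]  = refl

-- With α₀ + α₁ + α₂ = 0 the roots of A₂ in cyclic order, the alcove of w lies between the
-- hyperplanes αᵢ = xᵢ and αᵢ = xᵢ + 1 (α₂ shifted by one), so that the origin is the fundamental
-- alcove, the coordinates add up to 0 or -1, and ∣x₀∣ + ∣x₁∣ + ∣x₂∣ hyperplanes separate the two.
record Alcove : Set where
  constructor alc
  field x₀ x₁ x₂ : ℤ

coord : Alcove → S → ℤ
coord (alc x y z) 0F = x
coord (alc x y z) 1F = y
coord (alc x y z) 2F = z

-- The reflection in the wall of a generator negates the functional of its own coordinate, which on
-- lower bounds is x ↦ -1 - x. It exchanges the other two up to sign, and there the shift of α₂
-- absorbs the -1.
act : S → Alcove → Alcove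
act 0F (alc x y z) = alc (flip x) (ℤ.- z) (ℤ.- y)
act 1F (alc x y z) = alc (ℤ.- z) (flip y) (ℤ.- x)
act 2F (alc x y z) = alc (ℤ.- y) (ℤ.- x) (flip z)

alcove-ext : ∀ {m n} → (∀ i → coord m i ≡ coord n i) → m ≡ n
alcove-ext e with e 0F | e 1F | e 2F
... | refl | refl | refl = refl

coord-act : ∀ i m → coord (act i m) i ≡ flip (coord m i)
coord-act 0F m = refl
coord-act 1F m = refl
coord-act 2F m = refl

coord-act≢ : Tri a b c → ∀ m → coord (act a m) b ≡ ℤ.- coord m c
coord-act≢ t012 m = refl
coord-act≢ t120 m = refl
coord-act≢ t201 m = refl
coord-act≢ t021 m = refl
coord-act≢ t210 m = refl
coord-act≢ t102 m = refl

act-involutive : ∀ s m → act s (act s m) ≡ m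
act-involutive 0F (alc x y z) rewrite flip-involutive x | ℤ.neg-involutive y | ℤ.neg-involutive z = refl
act-involutive 1F (alc x y z) rewrite flip-involutive y | ℤ.neg-involutive x | ℤ.neg-involutive z = refl
act-involutive 2F (alc x y z) rewrite flip-involutive z | ℤ.neg-involutive x | ℤ.neg-involutive y = refl

act-injective : ∀ s {m n} → act s m ≡ act s n → m ≡ n
act-injective s {m} {n} e =
  trans (sym (act-involutive s m)) (trans (cong (act s) e) (act-involutive s n))

act-braid : Tri a b c → ∀ m → act a (act b (act a m)) ≡ act b (act a (act b m))
act-braid t012 (alc x y z) rewrite ℤ.neg-involutive x | ℤ.neg-involutive y | ℤ.neg-involutive (flip x) | ℤ.neg-involutive (flip y) = refl
act-braid t120 (alc x y z) rewrite ℤ.neg-involutive y | ℤ.neg-involutive z | ℤ.neg-involutive (flip y) | ℤ.neg-involutive (flip z) = refl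
act-braid t201 (alc x y z) rewrite ℤ.neg-involutive x | ℤ.neg-involutive z | ℤ.neg-involutive (flip x) | ℤ.neg-involutive (flip z) = refl
act-braid t021 (alc x y z) rewrite ℤ.neg-involutive x | ℤ.neg-involutive z | ℤ.neg-involutive (flip x) | ℤ.neg-involutive (flip z) = refl
act-braid t210 (alc x y z) rewrite ℤ.neg-involutive y | ℤ.neg-involutive z | ℤ.neg-involutive (flip y) | ℤ.neg-involutive (flip z) = refl
act-braid t102 (alc x y z) rewrite ℤ.neg-involutive x | ℤ.neg-involutive y | ℤ.neg-involutive (flip x) | ℤ.neg-involutive (flip y) = refl

origin : Alcove
origin = alc 0ℤ 0ℤ 0ℤ

total : Alcove → ℤ
total (alc x y z) = x ℤ.+ y ℤ.+ z

+-rotate : ∀ x y z → x ℤ.+ y ℤ.+ z ≡ y ℤ.+ z ℤ.+ x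
+-rotate = ℤSolver.solve-∀

+-swap₂₃ : ∀ x y z → x ℤ.+ y ℤ.+ z ≡ x ℤ.+ z ℤ.+ y
+-swap₂₃ = ℤSolver.solve-∀

total≡ : Tri a b c → ∀ m → total m ≡ coord m a ℤ.+ coord m b ℤ.+ coord m c
total≡ t012 (alc x y z) = refl
total≡ t120 (alc x y z) = +-rotate x y z
total≡ t201 (alc x y z) = sym (+-rotate z x y)
total≡ t021 (alc x y z) = +-swap₂₃ x y z
total≡ t210 (alc x y z) = trans (+-rotate x y z) (trans (+-rotate y z x) (+-swap₂₃ z x y))
total≡ t102 (alc x y z) = trans (+-rotate x y z) (+-swap₂₃ y z x)

total-act : ∀ s m → total (act s m) ≡ -1ℤ ℤ.- total m
total-act 0F (alc x y z) rewrite flip≡ x = h x y z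
  where
  h : ∀ x y z → (-1ℤ ℤ.- x) ℤ.+ ℤ.- z ℤ.+ ℤ.- y ≡ -1ℤ ℤ.- (x ℤ.+ y ℤ.+ z)
  h = ℤSolver.solve-∀
total-act 1F (alc x y z) rewrite flip≡ y = h x y z
  where
  h : ∀ x y z → ℤ.- z ℤ.+ (-1ℤ ℤ.- y) ℤ.+ ℤ.- x ≡ -1ℤ ℤ.- (x ℤ.+ y ℤ.+ z)
  h = ℤSolver.solve-∀
total-act 2F (alc x y z) rewrite flip≡ z = h x y z
  where
  h : ∀ x y z → ℤ.- y ℤ.+ ℤ.- x ℤ.+ (-1ℤ ℤ.- z) ≡ -1ℤ ℤ.- (x ℤ.+ y ℤ.+ z)
  h = ℤSolver.solve-∀

IsAlcove : Alcove → Set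
IsAlcove m = total m ≡ 0ℤ ⊎ total m ≡ -1ℤ

act-isAlcove : ∀ s {m} → IsAlcove m → IsAlcove (act s m)
act-isAlcove s {m} (inj₁ e) = inj₂ (trans (total-act s m) (cong (λ k → -1ℤ ℤ.- k) e))
act-isAlcove s {m} (inj₂ e) = inj₁ (trans (total-act s m) (cong (λ k → -1ℤ ℤ.- k) e))

data Neg : ℤ → Set where
  neg : ∀ {n} → Neg -[1+ n ]

data Pos : ℤ → Set where
  pos : ∀ {n} → Pos (+ suc n)

neg? : ∀ x → Dec (Neg x)
neg? (+ n)    = no λ ()
neg? -[1+ n ] = yes neg

Pos⇒¬Neg : ∀ {x} → Pos x → ¬ Neg x
Pos⇒¬Neg pos ()

Neg⇒Pos- : ∀ {x} → Neg x → Pos (ℤ.- x)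
Neg⇒Pos- neg = pos

Pos⇒Neg- : ∀ {x} → Pos x → Neg (ℤ.- x)
Pos⇒Neg- pos = neg

Neg-flip : ∀ {x} → ¬ Neg x → Neg (flip x)
Neg-flip {+ n}      _ = neg
Neg-flip { -[1+ n ]} h = ⊥-elim (h neg)

¬Neg-flip : ∀ {x} → Neg x → ¬ Neg (flip x)
¬Neg-flip neg ()

Desc : S → Alcove → Set
Desc s m = Neg (coord m s)

desc? : ∀ s m → Dec (Desc s m)
desc? s m = neg? (coord m s)

Desc-act : ∀ s {m} → ¬ Desc s m → Desc s (act s m)
Desc-act s {m} h = subst Neg (sym (coord-act s m)) (Neg-flip h)

¬Desc-act : ∀ s {m} → Desc s m → ¬ Desc s (act s m)
¬Desc-act s {m} h d = ¬Neg-flip h (subst Neg (coord-act s m) d)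

neg+neg : ∀ {x y} z → Neg x → Neg y → x ℤ.+ y ℤ.+ z ≡ 0ℤ ⊎ x ℤ.+ y ℤ.+ z ≡ -1ℤ → Pos z
neg+neg (+ zero)  neg neg (inj₁ ())
neg+neg (+ zero)  neg neg (inj₂ ())
neg+neg (+ suc n) neg neg _ = pos
neg+neg -[1+ n ]  neg neg (inj₁ ())
neg+neg -[1+ n ]  neg neg (inj₂ ())

isAlcove≡ : Tri a b c → ∀ {m} → IsAlcove m →
            coord m a ℤ.+ coord m b ℤ.+ coord m c ≡ 0ℤ ⊎ coord m a ℤ.+ coord m b ℤ.+ coord m c ≡ -1ℤ
isAlcove≡ T {m} (inj₁ e) = inj₁ (trans (sym (total≡ T m)) e)
isAlcove≡ T {m} (inj₂ e) = inj₂ (trans (sym (total≡ T m)) e)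

-- Two negative coordinates add up to at most -2, so a total of 0 or -1 forces the third to be at
-- least 1.
two-descents : Tri a b c → ∀ {m} → IsAlcove m → Desc a m → Desc b m → Pos (coord m c)
two-descents T i p q = neg+neg _ p q (isAlcove≡ T i)

no-three-descents : Tri a b c → ∀ {m} → IsAlcove m → Desc a m → Desc b m → ¬ Desc c m
no-three-descents T i p q = Pos⇒¬Neg (two-descents T i p q)

-- If `a` and `b` are both descents, the alcove is the longest in its orbit under these two
-- generators, so the length falls at each of the steps a, b, a. This and the next lemma supply the
-- last two steps.
dihedral₂ : Tri a b c → ∀ {m} → IsAlcove m → Desc a m → Desc b m → Desc b (act a m)
dihedral₂ T {m} i p q =
  subst Neg (sym (coord-act≢ T m)) (Pos⇒Neg- (two-descents T i p q))

dihedral₃ : Tri a b c → ∀ {m} → Desc b m → Desc a (act b (act a m))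
dihedral₃ {a} {b} T {m} q
  rewrite coord-act≢ (swap₁₂ T) (act a m) | coord-act≢ (swap₂₃ T) m | ℤ.neg-involutive (coord m b) = q

-- Acting by `a` puts the negative of coordinate `b` in place `c`. Combined with `≼-up`, this is
-- what allows a letter `c` to be dropped during lifting.
no-third-descent : Tri a b c → ∀ {m} → Desc b m → ¬ Desc c (act a m)
no-third-descent T {m} q d =
  Pos⇒¬Neg (Neg⇒Pos- q) (subst Neg (coord-act≢ (swap₂₃ T) m) d)

len : Alcove → ℕ
len (alc x y z) = ∣ x ∣ ℕ.+ ∣ y ∣ ℕ.+ ∣ z ∣

∣flip∣-neg : ∀ {x} → Neg x → ∣ x ∣ ≡ suc ∣ flip x ∣
∣flip∣-neg neg = refl

len-desc : ∀ s {m} → Desc s m → len m ≡ suc (len (act s m))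
len-desc 0F {alc x y z} d rewrite ∣flip∣-neg d | ℤ.∣-i∣≡∣i∣ y | ℤ.∣-i∣≡∣i∣ z = h (∣ flip x ∣) (∣ y ∣) (∣ z ∣)
  where
  h : ∀ x y z → suc x ℕ.+ y ℕ.+ z ≡ suc (x ℕ.+ z ℕ.+ y)
  h = ℕSolver.solve-∀
len-desc 1F {alc x y z} d rewrite ∣flip∣-neg d | ℤ.∣-i∣≡∣i∣ x | ℤ.∣-i∣≡∣i∣ z = h (∣ x ∣) (∣ flip y ∣) (∣ z ∣)
  where
  h : ∀ x y z → x ℕ.+ suc y ℕ.+ z ≡ suc (z ℕ.+ y ℕ.+ x)
  h = ℕSolver.solve-∀
len-desc 2F {alc x y z} d rewrite ∣flip∣-neg d | ℤ.∣-i∣≡∣i∣ x | ℤ.∣-i∣≡∣i∣ y = h (∣ x ∣) (∣ y ∣) (∣ flip z ∣)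
  where
  h : ∀ x y z → x ℕ.+ y ℕ.+ suc z ≡ suc (y ℕ.+ x ℕ.+ z)
  h = ℕSolver.solve-∀

len-asc : ∀ s {m} → ¬ Desc s m → len (act s m) ≡ suc (len m)
len-asc s {m} h = trans (len-desc s (Desc-act s h)) (cong (λ n → suc (len n)) (act-involutive s m))

len-act≤ : ∀ s m → len (act s m) ≤ suc (len m)
len-act≤ s m with desc? s m
... | yes d = ℕ.≤-trans (ℕ.n≤1+n _) (ℕ.≤-trans (ℕ.≤-reflexive (sym (len-desc s d))) (ℕ.n≤1+n _))
... | no ¬d = ℕ.≤-reflexive (len-asc s ¬d)

+-zeros : ∀ x y z → ¬ Neg x → ¬ Neg y → ¬ Neg z →
          x ℤ.+ y ℤ.+ z ≡ 0ℤ ⊎ x ℤ.+ y ℤ.+ z ≡ -1ℤ → alc x y z ≡ origin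
+-zeros (+ zero) (+ zero) (+ zero) _ _ _ _ = refl
+-zeros (+ zero) (+ zero) (+ suc _) _ _ _ (inj₁ ())
+-zeros (+ zero) (+ zero) (+ suc _) _ _ _ (inj₂ ())
+-zeros (+ zero) (+ suc _) (+ _) _ _ _ (inj₁ ())
+-zeros (+ zero) (+ suc _) (+ _) _ _ _ (inj₂ ())
+-zeros (+ suc _) (+ _) (+ _) _ _ _ (inj₁ ())
+-zeros (+ suc _) (+ _) (+ _) _ _ _ (inj₂ ())
+-zeros -[1+ _ ] _ _ h _ _ _ = ⊥-elim (h neg)
+-zeros (+ _) -[1+ _ ] _ _ h _ _ = ⊥-elim (h neg)
+-zeros (+ _) (+ _) -[1+ _ ] _ _ h _ = ⊥-elim (h neg)

pick : Alcove → S
pick m with desc? 0F m | desc? 1F m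
... | yes _ | _     = 0F
... | no _  | yes _ = 1F
-- This is also the default value at the origin, which has no descent and is excluded in
-- `pick-desc`.
... | no _  | no _  = 2F

pick-desc : ∀ {m} → IsAlcove m → m ≢ origin → Desc (pick m) m
pick-desc {m} i ne with desc? 0F m | desc? 1F m
... | yes d | _     = d
... | no _  | yes d = d
... | no d₀ | no d₁ with desc? 2F m
...   | yes d₂ = d₂
...   | no d₂  = ⊥-elim (ne (+-zeros _ _ _ d₀ d₁ d₂ i))

-- Normal forms and faithfulness of the action

φ : Word → Alcove
φ []      = origin
φ (s ∷ w) = act s (φ w)

ℓ : Word → ℕ
ℓ w = len (φ w)

φ-isAlcove : ∀ w → IsAlcove (φ w)
φ-isAlcove []      = inj₁ refl
φ-isAlcove (s ∷ w) = act-isAlcove s (φ-isAlcove w)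

¬Desc-[] : ∀ s → ¬ Desc s (φ [])
¬Desc-[] 0F ()
¬Desc-[] 1F ()
¬Desc-[] 2F ()

φ-++ : ∀ p {x y} → φ x ≡ φ y → φ (p ++ x) ≡ φ (p ++ y)
φ-++ []      e = e
φ-++ (s ∷ p) e = cong (act s) (φ-++ p e)

⟶⇒φ : ∀ {x y} → x ⟶ y → φ x ≡ φ y
⟶⇒φ (cancel σ p q) = φ-++ p (act-involutive σ (φ q))
⟶⇒φ (braid σ τ ne p q) = φ-++ p {σ ∷ τ ∷ σ ∷ q} {τ ∷ σ ∷ τ ∷ q} (act-braid (proj₂ (third σ τ ne)) (φ q))

≈⇒φ : ∀ {x y} → x ≈ y → φ x ≡ φ y
≈⇒φ = gfold isEquivalence φ ⟶⇒φ

ℓ≤length : ∀ w → ℓ w ≤ length w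
ℓ≤length []      = z≤n
ℓ≤length (s ∷ w) = ℕ.≤-trans (len-act≤ s (φ w)) (s≤s (ℓ≤length w))

-- The number is fuel: the word represents the alcove, and is then reduced, when it is started with
-- `len m`.
wordOf : ℕ → Alcove → Word
wordOf zero    m = []
wordOf (suc n) m = pick m ∷ wordOf n (act (pick m) m)

len≡0 : ∀ {m} → len m ≡ 0 → m ≡ origin
len≡0 {alc (+ zero) (+ zero) (+ zero)} _ = refl
len≡0 {alc (+ zero) (+ zero) (+ suc _)} ()
len≡0 {alc (+ zero) (+ zero) -[1+ _ ]} ()

φ-wordOf : ∀ n {m} → IsAlcove m → len m ≡ n → φ (wordOf n m) ≡ m
φ-wordOf zero    i e = sym (len≡0 e)
φ-wordOf (suc n) {m} i e =
  trans (cong (act (pick m)) (φ-wordOf n (act-isAlcove (pick m) i) (ℕ.suc-injective (trans (sym (len-desc (pick m) d)) e))))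
        (act-involutive (pick m) m)
  where
  d : Desc (pick m) m
  d = pick-desc {m} i λ { refl → case-0≡suc e }
    where
    case-0≡suc : ∀ {n} {A : Set} → 0 ≡ suc n → A
    case-0≡suc ()

length-wordOf : ∀ n m → length (wordOf n m) ≡ n
length-wordOf zero    m = refl
length-wordOf (suc n) m = cong suc (length-wordOf n _)

nf : Word → Word
nf w = wordOf (ℓ w) (φ w)

φ-nf : ∀ w → φ (nf w) ≡ φ w
φ-nf w = φ-wordOf (ℓ w) (φ-isAlcove w) refl

length-nf : ∀ w → length (nf w) ≡ ℓ w
length-nf w = length-wordOf (ℓ w) (φ w)

infix 4 _~_
-- Equivalence by braid moves alone. Without cancellation, subwords can be followed through each
-- move, as `~-⊆` does.
data _~_ : Word → Word → Set where
  ~-refl  : ∀ {x} → x ~ x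
  ~-trans : ∀ {x y z} → x ~ y → y ~ z → x ~ z
  ~-cons  : ∀ s {x y} → x ~ y → s ∷ x ~ s ∷ y
  ~-braid : Tri a b c → ∀ x → a ∷ b ∷ a ∷ x ~ b ∷ a ∷ b ∷ x

≈-cons : ∀ s {x y} → x ≈ y → (s ∷ x) ≈ (s ∷ y)
≈-cons s = gmap (s ∷_) λ
  { (cancel σ p q)     → cancel σ (s ∷ p) q
  ; (braid σ τ ne p q) → braid σ τ ne (s ∷ p) q }

~⇒≈ : ∀ {x y} → x ~ y → x ≈ y
~⇒≈ ~-refl        = ε
~⇒≈ (~-trans p q) = ~⇒≈ p ◅◅ ~⇒≈ q
~⇒≈ (~-cons s p)  = ≈-cons s (~⇒≈ p)
~⇒≈ (~-braid T x) = return (fwd (braid _ _ (Tri⇒≢ T) [] x))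

ℓ≡length-tail : ∀ s w → ℓ (s ∷ w) ≡ suc (length w) → ℓ w ≡ length w
ℓ≡length-tail s w e = ℕ.≤-antisym (ℓ≤length w) (ℕ.s≤s⁻¹ (subst (_≤ suc (ℓ w)) e (len-act≤ s (φ w))))

ℓ≡length⇒Desc : ∀ s w → ℓ (s ∷ w) ≡ suc (length w) → Desc s (φ (s ∷ w))
ℓ≡length⇒Desc s w e with desc? s (φ w)
... | no h  = Desc-act s h
... | yes d = ⊥-elim (ℕ.<-irrefl e (ℕ.≤-trans (ℕ.≤-reflexive (sym (len-desc s d))) (ℕ.≤-trans (ℓ≤length w) (ℕ.n≤1+n _))))

-- Equal first letters are stripped. Different first letters `s` and `t` are both descents of the
-- common alcove, which therefore has reduced words s·t·s·q and t·s·t·q. These differ by one braid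
-- move, and induction links each of them to the given word with the same first letter.
matsumoto : ∀ n x y → length x ≡ n → length y ≡ n → ℓ x ≡ n → φ x ≡ φ y → x ~ y
matsumoto zero [] [] _ _ _ _ = ~-refl
matsumoto (suc n) (s ∷ x) (t ∷ y) lx ey lℓ e with s ≟ t
... | yes refl = ~-cons s (matsumoto n x y (ℕ.suc-injective lx) (ℕ.suc-injective ey)
                   (trans (ℓ≡length-tail s x (trans lℓ (sym lx))) (ℕ.suc-injective lx)) (act-injective s e))
... | no ne with third s t ne
...   | r , T = ~-trans (~-cons s x~) (~-trans (~-braid T q) (~-cons t ~y))
  where
  ex : ℓ (s ∷ x) ≡ suc (length x)
  ex = trans lℓ (sym lx)
  ey' : ℓ (t ∷ y) ≡ suc (length y)
  ey' = trans (cong len (sym e)) (trans lℓ (sym ey))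
  ℓx : ℓ x ≡ n
  ℓx = trans (ℓ≡length-tail s x ex) (ℕ.suc-injective lx)
  m = φ (s ∷ x)
  im = φ-isAlcove (s ∷ x)
  ds : Desc s m
  ds = ℓ≡length⇒Desc s x ex
  dt : Desc t m
  dt = subst (Desc t) (sym e) (ℓ≡length⇒Desc t y ey')
  dt₂ : Desc t (act s m)
  dt₂ = dihedral₂ T im ds dt
  ds₃ : Desc s (act t (act s m))
  ds₃ = dihedral₃ T {m} dt
  m₃ = act s (act t (act s m))
  im₃ : IsAlcove m₃
  im₃ = act-isAlcove s (act-isAlcove t (act-isAlcove s im))
  q = wordOf (len m₃) m₃
  φz : φ q ≡ m₃
  φz = φ-wordOf (len m₃) im₃ refl
  ez : suc (suc (suc (length q))) ≡ suc n
  ez = begin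
    suc (suc (suc (length q)))           ≡⟨ cong (λ k → suc (suc (suc k))) (length-wordOf (len m₃) m₃) ⟩
    suc (suc (suc (len m₃)))             ≡⟨ cong (λ k → suc (suc k)) (len-desc s ds₃) ⟨
    suc (suc (len (act t (act s m))))    ≡⟨ cong suc (len-desc t dt₂) ⟨
    suc (len (act s m))                  ≡⟨ len-desc s ds ⟨
    len m                                ≡⟨ lℓ ⟩
    suc n                                ∎
    where open ≡-Reasoning
  φtsz : φ (t ∷ s ∷ q) ≡ act s m
  φtsz = trans (cong (λ k → act t (act s k)) φz)
         (trans (cong (act t) (act-involutive s _)) (act-involutive t _))
  x~ : x ~ t ∷ s ∷ q
  x~ = matsumoto n x (t ∷ s ∷ q) (ℕ.suc-injective lx) (ℕ.suc-injective ez) ℓx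
         (sym (trans φtsz (act-involutive s (φ x))))
  φstz : φ (s ∷ t ∷ q) ≡ φ y
  φstz = act-injective t (trans (sym (act-braid T (φ q))) (trans (cong (act s) φtsz) (trans (act-involutive s m) e)))
  ~y : s ∷ t ∷ q ~ y
  ~y = matsumoto n (s ∷ t ∷ q) y (ℕ.suc-injective ez) (ℕ.suc-injective ey)
         (trans (cong len φstz) (trans (ℓ≡length-tail t y ey') (ℕ.suc-injective ey))) φstz

-- The normal form is reached letter by letter; a letter that shortens is first exposed at the front
-- of the rest by braid moves and then cancelled. As `nf w` depends only on the alcove of w, the
-- action is faithful.
≈-nf : ∀ w → w ≈ nf w
≈-nf []      = ε
≈-nf (s ∷ w) with desc? s (φ w)
... | no h = ≈-cons s (≈-nf w) ◅◅ ~⇒≈ (matsumoto (suc (ℓ w)) (s ∷ nf w) (nf (s ∷ w))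
               (cong suc (length-nf w)) (trans (length-nf (s ∷ w)) (len-asc s h))
               (trans (cong (λ m → len (act s m)) (φ-nf w)) (len-asc s h))
               (trans (cong (act s) (φ-nf w)) (sym (φ-nf (s ∷ w)))))
... | yes d = ≈-cons s (≈-nf w ◅◅ ~⇒≈ (matsumoto (ℓ w) (nf w) (s ∷ nf (s ∷ w))
               (length-nf w) (trans (cong suc (length-nf (s ∷ w))) (sym (len-desc s d)))
               (cong len (φ-nf w))
               (trans (φ-nf w) (sym (trans (cong (act s) (φ-nf (s ∷ w))) (act-involutive s (φ w)))))))
               ◅◅ return (fwd (cancel s [] (nf (s ∷ w))))

≈-sym : ∀ {x y} → x ≈ y → y ≈ x
≈-sym = symmetric _⟶_

φ⇒≈ : ∀ {x y} → φ x ≡ φ y → x ≈ y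
φ⇒≈ {x} {y} e = subst (x ≈_) (cong (λ m → wordOf (len m) m) e) (≈-nf x) ◅◅ ≈-sym (≈-nf y)

Reduced⇒ℓ : ∀ {w} → Reduced w → ℓ w ≡ length w
Reduced⇒ℓ {w} r = ℕ.≤-antisym (ℓ≤length w) (subst (length w ≤_) (length-nf w) (r (nf w) (≈-sym (≈-nf w))))

ℓ⇒Reduced : ∀ {w} → ℓ w ≡ length w → Reduced w
ℓ⇒Reduced {w} e w' w'≈w = subst (_≤ length w') (trans (cong len (≈⇒φ w'≈w)) e) (ℓ≤length w')

nf-reduced : ∀ w → Reduced (nf w)
nf-reduced w = ℓ⇒Reduced (trans (cong len (φ-nf w)) (sym (length-nf w)))

-- Exchange and the Bruhat order

-- The successor relation, split by sign: `up⁰` is the only step that changes whether a coordinate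
-- is negative.
data Up : ℤ → ℤ → Set where
  up⁺ : ∀ {n} → Up (+ n) (+ suc n)
  up⁰ : Up -1ℤ 0ℤ
  up⁻ : ∀ {n} → Up -[1+ suc n ] -[1+ n ]

Up-flip : ∀ {i j} → Up i j → Up (flip j) (flip i)
Up-flip up⁺ = up⁻
Up-flip up⁰ = up⁰
Up-flip up⁻ = up⁺

Up-neg : ∀ {i j} → Up i j → Up (ℤ.- j) (ℤ.- i)
Up-neg (up⁺ {zero})  = up⁰
Up-neg (up⁺ {suc n}) = up⁻
Up-neg up⁰           = up⁺
Up-neg up⁻           = up⁺

Up-sign : ∀ {i j} → Up i j → Neg i → ¬ Neg j → i ≡ -1ℤ × j ≡ 0ℤ
Up-sign up⁰ _ _ = refl , refl
Up-sign up⁻ _ h = ⊥-elim (h neg)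

Up-¬Neg : ∀ {i j} → Up i j → ¬ Neg i → ¬ Neg j
Up-¬Neg up⁺ _ ()
Up-¬Neg up⁻ h neg = h neg

Adjacent : Alcove → Alcove → Set
Adjacent m n = Σ S λ i → (Up (coord m i) (coord n i) ⊎ Up (coord n i) (coord m i))
                       × (∀ j → j ≢ i → coord m j ≡ coord n j)

Adjacent-sym : ∀ {m n} → Adjacent m n → Adjacent n m
Adjacent-sym (i , d , e) = i , Sum.swap d , λ j ne → sym (e j ne)

Adjacent-act : ∀ s {m n} → Adjacent m n → Adjacent (act s m) (act s n)
Adjacent-act s {m} {n} (i , d , e) with s ≟ i
... | yes refl = s , up , eq
  where
  up : Up (coord (act s m) s) (coord (act s n) s) ⊎ Up (coord (act s n) s) (coord (act s m) s)
  up rewrite coord-act s m | coord-act s n = Sum.swap (Sum.map Up-flip Up-flip d)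
  eq : ∀ j → j ≢ s → coord (act s m) j ≡ coord (act s n) j
  eq j ne with third s j (λ p → ne (sym p))
  ... | k , T rewrite coord-act≢ T m | coord-act≢ T n = cong ℤ.-_ (e k (λ p → Tri⇒≢ (swap₂₃ T) (sym p)))
... | no s≢i with third s i s≢i
...   | k , T = k , up , eq
  where
  up : Up (coord (act s m) k) (coord (act s n) k) ⊎ Up (coord (act s n) k) (coord (act s m) k)
  up rewrite coord-act≢ (swap₂₃ T) m | coord-act≢ (swap₂₃ T) n = Sum.swap (Sum.map Up-neg Up-neg d)
  eq : ∀ j → j ≢ k → coord (act s m) j ≡ coord (act s n) j
  eq j ne with Tri-cover T j
  ... | inj₁ refl rewrite coord-act s m | coord-act s n = cong flip (e s s≢i)
  ... | inj₂ (inj₁ refl) rewrite coord-act≢ T m | coord-act≢ T n = cong ℤ.-_ (e k (λ p → ne (sym p)))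
  ... | inj₂ (inj₂ refl) = ⊥-elim (ne refl)

-- At the origin this is a check of three walls, and the left action carries adjacent alcoves to
-- adjacent alcoves.
Adjacent-∷ʳ : ∀ p t → Adjacent (φ p) (φ (p ++ t ∷ []))
Adjacent-∷ʳ []      0F = 0F , inj₂ up⁰ , λ { 0F ne → ⊥-elim (ne refl) ; 1F _ → refl ; 2F _ → refl }
Adjacent-∷ʳ []      1F = 1F , inj₂ up⁰ , λ { 0F _ → refl ; 1F ne → ⊥-elim (ne refl) ; 2F _ → refl }
Adjacent-∷ʳ []      2F = 2F , inj₂ up⁰ , λ { 0F _ → refl ; 1F _ → refl ; 2F ne → ⊥-elim (ne refl) }
Adjacent-∷ʳ (s ∷ p) t  = Adjacent-act s (Adjacent-∷ʳ p t)

opposite : ∀ p q → 0ℤ ℤ.+ p ℤ.+ q ≡ 0ℤ ⊎ 0ℤ ℤ.+ p ℤ.+ q ≡ -1ℤ →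
           -1ℤ ℤ.+ p ℤ.+ q ≡ 0ℤ ⊎ -1ℤ ℤ.+ p ℤ.+ q ≡ -1ℤ → ℤ.- q ≡ p
opposite p q (inj₁ e) _ = trans (sym (ℤ.+-identityˡ (ℤ.- q))) (trans (cong (ℤ._+ ℤ.- q) (sym e)) (h p q))
  where
  h : ∀ p q → 0ℤ ℤ.+ p ℤ.+ q ℤ.+ ℤ.- q ≡ p
  h = ℤSolver.solve-∀
opposite p q (inj₂ e) h = ⊥-elim (no₂ (subst (λ k → k ≡ 0ℤ ⊎ k ≡ -1ℤ) e' h))
  where
  e' : -1ℤ ℤ.+ p ℤ.+ q ≡ -[1+ 1 ]
  e' = trans (ℤ.+-assoc -1ℤ p q) (cong (λ k → -1ℤ ℤ.+ k) (trans (cong (ℤ._+ q) (sym (ℤ.+-identityˡ p))) e))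
  no₂ : ¬ (-[1+ 1 ] ≡ 0ℤ ⊎ -[1+ 1 ] ≡ -1ℤ)
  no₂ (inj₁ ())
  no₂ (inj₂ ())

-- Coordinate `s` passes from 0 to -1 and the others agree. Both totals being admissible, these
-- others add up to 0 by `opposite`, so exchanging and negating them changes nothing.
cross-wall : ∀ {m n} → IsAlcove m → IsAlcove n → Adjacent m n → ¬ Desc s m → Desc s n → act s m ≡ n
cross-wall {s} {m} {n} im in' (i , d , e) ¬dm dn with s ≟ i
... | no s≢i = ⊥-elim (¬dm (subst Neg (sym (e s s≢i)) dn))
... | yes refl with d
...   | inj₁ up = ⊥-elim (Up-¬Neg up ¬dm dn)
...   | inj₂ up with Up-sign up dn ¬dm
...     | n≡ , m≡ = alcove-ext eq
  where
  eq : ∀ j → coord (act s m) j ≡ coord n j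
  eq j with s ≟ j
  ... | yes refl = trans (coord-act s m) (trans (cong flip m≡) (sym n≡))
  ... | no s≢j with third s j s≢j
  ...   | k , T = trans (coord-act≢ T m) (trans (opposite (coord m j) (coord m k) hm hn) ej)
    where
    ej = e j (λ p → s≢j (sym p))
    ek = e k (λ p → Tri⇒≢ (swap₂₃ T) (sym p))
    hm = subst (λ k' → k' ℤ.+ coord m j ℤ.+ coord m k ≡ 0ℤ ⊎ k' ℤ.+ coord m j ℤ.+ coord m k ≡ -1ℤ) m≡ (isAlcove≡ T im)
    hn = subst₂ (λ q r → -1ℤ ℤ.+ q ℤ.+ r ≡ 0ℤ ⊎ -1ℤ ℤ.+ q ℤ.+ r ≡ -1ℤ) (sym ej) (sym ek)
           (subst (λ k' → k' ℤ.+ coord n j ℤ.+ coord n k ≡ 0ℤ ⊎ k' ℤ.+ coord n j ℤ.+ coord n k ≡ -1ℤ) n≡ (isAlcove≡ T in'))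

Separates : S → Alcove → Alcove → Set
Separates s m n = (¬ Desc s m × Desc s n) ⊎ (Desc s m × ¬ Desc s n)

¬Separates-self : ∀ {m} → ¬ Separates s m m
¬Separates-self (inj₁ (h , d)) = h d
¬Separates-self (inj₂ (d , h)) = h d

separates-∷ʳ : ∀ p t → Separates s (φ p) (φ (p ++ t ∷ [])) → act s (φ p) ≡ φ (p ++ t ∷ [])
separates-∷ʳ p t (inj₁ (h , d)) =
  cross-wall (φ-isAlcove p) (φ-isAlcove (p ++ t ∷ [])) (Adjacent-∷ʳ p t) h d
separates-∷ʳ {s} p t (inj₂ (d , h)) =
  trans (cong (act s) (sym (cross-wall (φ-isAlcove (p ++ t ∷ [])) (φ-isAlcove p) (Adjacent-sym (Adjacent-∷ʳ p t)) h d)))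
        (act-involutive s _)

≈-++ʳ : ∀ w → x ≈ y → (x ++ w) ≈ (y ++ w)
≈-++ʳ w = gmap (_++ w) λ
  { (cancel σ p q)     → subst₂ _⟶_ (sym (++-assoc p _ w)) (sym (++-assoc p q w)) (cancel σ p (q ++ w))
  ; (braid σ τ ne p q) → subst₂ _⟶_ (sym (++-assoc p _ w)) (sym (++-assoc p _ w)) (braid σ τ ne p (q ++ w)) }

φ-++ʳ : ∀ w → φ x ≡ φ y → φ (x ++ w) ≡ φ (y ++ w)
φ-++ʳ {x} {y} w e = ≈⇒φ (≈-++ʳ w (φ⇒≈ {x} {y} e))

-- Walking from p to p w, one letter of w crosses the wall of s; deleting it folds the path.
strong-exchange : ∀ p w → Separates s (φ p) (φ (p ++ w)) →
                  Σ Word λ w' → w' ⊆ w × φ (p ++ w') ≡ act s (φ (p ++ w))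
strong-exchange {s} p [] sep =
  ⊥-elim (¬Separates-self {s} {φ p} (subst (λ q → Separates s (φ p) (φ q)) (++-identityʳ p) sep))
strong-exchange {s} p (t ∷ w) sep = go sep (desc? s (φ (p ++ t ∷ [])))
  where
  Goal = Σ Word λ w' → w' ⊆ t ∷ w × φ (p ++ w') ≡ act s (φ (p ++ t ∷ w))
  skip : Separates s (φ p) (φ (p ++ t ∷ [])) → Goal
  skip h = w , t ∷ʳ ⊆-refl , sym (trans (cong (act s) eq) (act-involutive s _))
    where
    eq : φ (p ++ t ∷ w) ≡ act s (φ (p ++ w))
    eq = trans (cong φ (sym (∷ʳ-++ p t w))) (φ-++ʳ {p ++ t ∷ []} {s ∷ p} w (sym (separates-∷ʳ p t h)))
  deeper : Separates s (φ (p ++ t ∷ [])) (φ (p ++ t ∷ w)) → Goal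
  deeper h with strong-exchange (p ++ t ∷ []) w (subst (λ q → Separates s (φ (p ++ t ∷ [])) (φ q)) (sym (∷ʳ-++ p t w)) h)
  ... | w' , w'⊆w , e = t ∷ w' , refl ∷ w'⊆w ,
        trans (cong φ (sym (∷ʳ-++ p t w'))) (trans e (cong (λ q → act s (φ q)) (∷ʳ-++ p t w)))
  go : Separates s (φ p) (φ (p ++ t ∷ w)) → Dec (Desc s (φ (p ++ t ∷ []))) → Goal
  go (inj₁ (h₀ , d₂)) (yes d₁) = skip (inj₁ (h₀ , d₁))
  go (inj₁ (h₀ , d₂)) (no h₁)  = deeper (inj₁ (h₁ , d₂))
  go (inj₂ (d₀ , h₂)) (yes d₁) = deeper (inj₂ (d₁ , h₂))
  go (inj₂ (d₀ , h₂)) (no h₁)  = skip (inj₂ (d₀ , h₁))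

exchange : Desc s (φ w) → Σ Word λ w' → w' ⊆ w × φ w' ≡ φ (s ∷ w)
exchange {s} {w} d = strong-exchange [] w (inj₁ (¬Desc-[] s , d))

infix 4 _≼_
-- The Bruhat order read off from the given word of w instead of from some reduced expression; this
-- makes recursion on w and decidability possible.
record _≼_ (x w : Word) : Set where
  constructor sub
  field
    subword   : Word
    isSubword : subword ⊆ w
    φ≡        : φ subword ≡ φ x

≼-respˡ : φ x ≡ φ y → x ≼ w → y ≼ w
≼-respˡ e (sub v p h) = sub v p (trans h e)

⊆⇒≼ : x ⊆ w → x ≼ w
⊆⇒≼ p = sub _ p refl

≼-⊆ : x ≼ v → v ⊆ w → x ≼ w
≼-⊆ (sub v p e) q = sub v (⊆-trans p q) e

≼-cons : ∀ s → x ≼ w → s ∷ x ≼ s ∷ w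
≼-cons s (sub v p e) = sub (s ∷ v) (refl ∷ p) (cong (act s) e)

≼-step : ∀ s → x ≼ w → x ≼ s ∷ w
≼-step s (sub v p e) = sub v (s ∷ʳ p) e

-- The lifting property. If the subword for x uses the leading `s`, then `s` is a descent of what
-- follows, and exchange removes both. `≼-down` is the counterpart for a descent.
≼-up : ∀ s x → x ≼ s ∷ w → ¬ Desc s (φ x) → x ≼ w
≼-up s x (sub v (_ ∷ʳ p) e) h = sub v p e
≼-up s x (sub (_ ∷ v) (refl ∷ p) e) h
  with exchange {s} {v} (subst (Desc s) (act-involutive s (φ v)) (Desc-act s (λ d → h (subst (Desc s) e d))))
... | v' , q , e' = sub v' (⊆-trans q p) (trans e' e)

≼-down : ∀ s x → x ≼ s ∷ w → Desc s (φ x) → s ∷ x ≼ w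
≼-down s x (sub v (_ ∷ʳ p) e) d with exchange {s} {v} (subst (Desc s) (sym e) d)
... | v' , q , e' = sub v' (⊆-trans q p) (trans e' (cong (act s) e))
≼-down s x (sub (_ ∷ v) (refl ∷ p) e) d = sub v p (trans (sym (act-involutive s (φ v))) (cong (act s) e))

infix 4 _≼?_
_≼?_ : ∀ x w → Dec (x ≼ w)
x ≼? [] with ℓ x in e
... | zero  = yes (sub [] [] (sym (len≡0 e)))
... | suc n = no λ { (sub _ [] h) → 0≢suc (trans (cong len h) e) }
  where
  0≢suc : 0 ≢ suc n
  0≢suc ()
x ≼? s ∷ w with desc? s (φ x)
... | yes d = map′ (λ p → ≼-respˡ {s ∷ s ∷ x} (act-involutive s (φ x)) (≼-cons s p)) (λ p → ≼-down s x p d) (s ∷ x ≼? w)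
... | no h  = map′ (≼-step s) (λ p → ≼-up s x p h) (x ≼? w)

⊆-length : v ⊆ w → length v ≤ length w
⊆-length []         = z≤n
⊆-length (_ ∷ʳ p)   = ℕ.m≤n⇒m≤1+n (⊆-length p)
⊆-length (refl ∷ p) = s≤s (⊆-length p)

⊆-length≡ : v ⊆ w → length w ≤ length v → v ≡ w
⊆-length≡ []         _       = refl
⊆-length≡ (_ ∷ʳ p)   h       = ⊥-elim (ℕ.<-irrefl refl (ℕ.≤-trans h (⊆-length p)))
⊆-length≡ (refl ∷ p) (s≤s h) = cong (_ ∷_) (⊆-length≡ p h)

≼-ℓ : x ≼ w → ℓ x ≤ length w
≼-ℓ {x} (sub v p e) = ℕ.≤-trans (ℕ.≤-reflexive (cong len (sym e))) (ℕ.≤-trans (ℓ≤length v) (⊆-length p))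

≼-antisym : x ≼ w → length w ≤ ℓ x → φ x ≡ φ w
≼-antisym (sub v p e) h =
  trans (sym e) (cong φ (⊆-length≡ p (ℕ.≤-trans h (ℕ.≤-trans (ℕ.≤-reflexive (cong len (sym e))) (ℓ≤length v)))))

-- Reversal and right descents

reverse-mid : ∀ (p r q : Word) → reverse (p ++ r ++ q) ≡ reverse q ++ reverse r ++ reverse p
reverse-mid p r q = trans (reverse-++ p (r ++ q)) (trans (cong (_++ reverse p) (reverse-++ r q)) (++-assoc (reverse q) (reverse r) (reverse p)))

≈-reverse : x ≈ y → reverse x ≈ reverse y
≈-reverse = gmap reverse λ
  { (cancel σ p q)     → subst₂ _⟶_ (sym (reverse-mid p (σ ∷ σ ∷ []) q)) (sym (reverse-++ p q)) (cancel σ (reverse q) (reverse p))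
  ; (braid σ τ ne p q) → subst₂ _⟶_ (sym (reverse-mid p (σ ∷ τ ∷ σ ∷ []) q)) (sym (reverse-mid p (τ ∷ σ ∷ τ ∷ []) q))
                           (braid σ τ ne (reverse q) (reverse p)) }

φ-reverse : φ x ≡ φ y → φ (reverse x) ≡ φ (reverse y)
φ-reverse {x} {y} e = ≈⇒φ (≈-reverse (φ⇒≈ {x} {y} e))

reverse-snoc : ∀ (x : Word) s → reverse (x ++ s ∷ []) ≡ s ∷ reverse x
reverse-snoc x s = reverse-++ x (s ∷ [])

ℓ-reverse≤ : ∀ w → ℓ (reverse w) ≤ ℓ w
ℓ-reverse≤ w = subst₂ _≤_ (cong len (φ-reverse {nf w} {w} (φ-nf w)))
  (trans (length-reverse (nf w)) (length-nf w)) (ℓ≤length (reverse (nf w)))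

ℓ-reverse : ∀ w → ℓ (reverse w) ≡ ℓ w
ℓ-reverse w = ℕ.≤-antisym (ℓ-reverse≤ w) (subst (λ k → ℓ k ≤ ℓ (reverse w)) (reverse-involutive w) (ℓ-reverse≤ (reverse w)))

≼-reverse : x ≼ w → reverse x ≼ reverse w
≼-reverse {x} (sub v p e) = sub (reverse v) (reverse⁺ p) (φ-reverse {v} {x} e)

ℓ-∷≥ : ∀ s x → ℓ x ≤ suc (ℓ (s ∷ x))
ℓ-∷≥ s x = subst (λ m → len m ≤ suc (ℓ (s ∷ x))) (act-involutive s (φ x)) (len-act≤ s (act s (φ x)))

ℓ-snoc : ∀ x s → ℓ (x ++ s ∷ []) ≡ ℓ (s ∷ reverse x)
ℓ-snoc x s = trans (sym (ℓ-reverse (x ++ s ∷ []))) (cong ℓ (reverse-snoc x s))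

ℓ-snoc≥ : ∀ x s → ℓ x ≤ suc (ℓ (x ++ s ∷ []))
ℓ-snoc≥ x s = subst₂ (λ i j → i ≤ suc j) (ℓ-reverse x) (sym (ℓ-snoc x s)) (ℓ-∷≥ s (reverse x))

-- Otherwise σu would be longer than u by one and σus shorter than u by two, although a single
-- letter changes the length by at most one.
Desc-snoc : ∀ σ u → Desc s (φ (reverse u)) → Desc σ (φ (u ++ s ∷ [])) → Desc σ (φ u)
Desc-snoc {s} σ u dR d with desc? σ (φ u)
... | yes p = p
... | no h = ⊥-elim (ℕ.<-irrefl {ℓ u} refl (ℕ.≤-trans (ℕ.≤-reflexive (sym (len-asc σ h)))
               (ℕ.≤-trans (ℓ-snoc≥ (σ ∷ u) s) (ℕ.≤-trans (ℕ.≤-reflexive (sym (len-desc σ d)))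
               (ℕ.≤-trans (ℕ.n≤1+n _) (ℕ.≤-reflexive (trans (cong suc (ℓ-snoc u s)) (trans (sym (len-desc s dR)) (ℓ-reverse u)))))))))

-- Comparison with the Bruhat order and the descent sets

~-⊆ : x ~ y → v ⊆ x → v ≼ y
~-⊆ ~-refl p = ⊆⇒≼ p
~-⊆ (~-trans h k) p with ~-⊆ h p
... | sub v' p' e = ≼-respˡ {v'} e (~-⊆ k p')
~-⊆ (~-cons s h) (_ ∷ʳ p)   = ≼-step s (~-⊆ h p)
~-⊆ (~-cons s h) (refl ∷ p) = ≼-cons s (~-⊆ h p)
-- Each subword of aba is also one of bab, with two exceptions: aba itself is replaced by bab, and
-- a·a by the empty word.
~-⊆ (~-braid {a} {b} T x) (refl ∷ refl ∷ refl ∷ p) = sub (b ∷ a ∷ b ∷ _) (refl ∷ refl ∷ refl ∷ p) (sym (act-braid T _))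
~-⊆ (~-braid {a} {b} T x) (refl ∷ refl ∷ _ ∷ʳ p)    = ⊆⇒≼ (b ∷ʳ refl ∷ refl ∷ p)
~-⊆ (~-braid {a} {b} T x) (refl ∷ _ ∷ʳ refl ∷ p)    = sub _ (b ∷ʳ a ∷ʳ b ∷ʳ p) (sym (act-involutive a _))
~-⊆ (~-braid {a} {b} T x) (refl ∷ _ ∷ʳ _ ∷ʳ p)      = ⊆⇒≼ (b ∷ʳ refl ∷ b ∷ʳ p)
~-⊆ (~-braid {a} {b} T x) (_ ∷ʳ refl ∷ refl ∷ p)    = ⊆⇒≼ (refl ∷ refl ∷ b ∷ʳ p)
~-⊆ (~-braid {a} {b} T x) (_ ∷ʳ refl ∷ _ ∷ʳ p)      = ⊆⇒≼ (refl ∷ a ∷ʳ b ∷ʳ p)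
~-⊆ (~-braid {a} {b} T x) (_ ∷ʳ _ ∷ʳ refl ∷ p)      = ⊆⇒≼ (b ∷ʳ refl ∷ b ∷ʳ p)
~-⊆ (~-braid {a} {b} T x) (_ ∷ʳ _ ∷ʳ _ ∷ʳ p)        = ⊆⇒≼ (b ∷ʳ a ∷ʳ b ∷ʳ p)

≤B⇒≼ : Reduced w → x ≤B w → x ≼ w
≤B⇒≼ {w} rw (w' , rw' , w'≈w , v , p , v≈x) =
  ≼-respˡ {v} (≈⇒φ v≈x) (~-⊆ (matsumoto (length w) w' w len≡ refl
    (trans (cong len (≈⇒φ w'≈w)) (Reduced⇒ℓ rw)) (≈⇒φ w'≈w)) p)
  where
  len≡ : length w' ≡ length w
  len≡ = trans (sym (Reduced⇒ℓ rw')) (trans (cong len (≈⇒φ w'≈w)) (Reduced⇒ℓ rw))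

≼⇒≤B : Reduced w → x ≼ w → x ≤B w
≼⇒≤B {x = x} rw (sub v p e) = _ , rw , ε , v , p , φ⇒≈ {v} {x} e

Desc⇒InL : ∀ u σ → Desc σ (φ u) → InL u σ
Desc⇒InL u σ d with exchange {σ} {nf u} (subst (Desc σ) (sym (φ-nf u)) d)
... | v , p , e = (nf u , nf-reduced u , ≈-sym (≈-nf u) , v , p , φ⇒≈ {v} {σ ∷ u} (trans e (cong (act σ) (φ-nf u)))) ,
                  λ h → ℕ.<-irrefl (cong len (≈⇒φ h)) (ℕ.≤-reflexive (sym (len-desc σ d)))

InL⇒Desc : ∀ u σ → InL u σ → Desc σ (φ u)
InL⇒Desc u σ ((w' , rw' , w'≈u , v , p , v≈) , _) with desc? σ (φ u)
... | yes d = d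
... | no h = ⊥-elim (ℕ.<-irrefl {ℓ u} refl (ℕ.≤-trans (ℕ.≤-reflexive (sym (len-asc σ h)))
               (ℕ.≤-trans (≼-ℓ {σ ∷ u} (sub v p (≈⇒φ v≈))) (ℕ.≤-reflexive (trans (sym (Reduced⇒ℓ rw')) (cong len (≈⇒φ w'≈u)))))))

Reduced-reverse : Reduced w → Reduced (reverse w)
Reduced-reverse {w} r = ℓ⇒Reduced (trans (ℓ-reverse w) (trans (Reduced⇒ℓ r) (sym (length-reverse w))))

≤B-reverse : x ≤B w → reverse x ≤B reverse w
≤B-reverse (w' , r , e , v , p , e') = reverse w' , Reduced-reverse r , ≈-reverse e , reverse v , reverse⁺ p , ≈-reverse e'

InR⇒Desc : ∀ u σ → InR u σ → Desc σ (φ (reverse u))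
InR⇒Desc u σ (h , ne) = InL⇒Desc (reverse u) σ
  (subst (_≤B reverse u) (reverse-snoc u σ) (≤B-reverse h) ,
   λ e → ne (subst₂ _≈_ (trans (cong reverse (sym (reverse-snoc u σ))) (reverse-involutive _)) (reverse-involutive u) (≈-reverse e)))

Desc⇒InR : ∀ u σ → Desc σ (φ (reverse u)) → InR u σ
Desc⇒InR u σ d with Desc⇒InL (reverse u) σ d
... | h , ne = subst₂ _≤B_ (trans (cong reverse (sym (reverse-snoc u σ))) (reverse-involutive _)) (reverse-involutive u) (≤B-reverse h) ,
   λ e → ne (subst (_≈ reverse u) (reverse-snoc u σ) (≈-reverse e))

-- Kazhdan–Lusztig polynomials in colength at most three

Reduced-tail : Reduced (s ∷ v) → Reduced v
Reduced-tail {s} {v} r = ℓ⇒Reduced (ℓ≡length-tail s v (Reduced⇒ℓ r))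

Reduced⇒Desc : Reduced (s ∷ v) → Desc s (φ (s ∷ v))
Reduced⇒Desc {s} {v} r = ℓ≡length⇒Desc s v (Reduced⇒ℓ r)

Reduced⇒¬Desc : Reduced (s ∷ v) → ¬ Desc s (φ v)
Reduced⇒¬Desc {s} {v} r d = ¬Desc-act s d (Reduced⇒Desc r)

Reduced-cons : Reduced v → ¬ Desc s (φ v) → Reduced (s ∷ v)
Reduced-cons {s = s} r h = ℓ⇒Reduced (trans (len-asc s h) (cong suc (Reduced⇒ℓ r)))

≼-respʳ : Reduced v → Reduced w → φ v ≡ φ w → x ≼ v → x ≼ w
≼-respʳ {v} {w} rv rw e (sub y p h) =
  ≼-respˡ {y} h (~-⊆ (matsumoto (length w) v w
    (trans (sym (Reduced⇒ℓ rv)) (trans (cong len e) (Reduced⇒ℓ rw))) refl (trans (cong len e) (Reduced⇒ℓ rw)) e) p)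

-- It suffices to pass to a reduced expression of w beginning with `s`, where s can be added to or
-- removed from the front of a subword.
≼-closed : Reduced w → Desc s (φ w) → x ≼ w → s ∷ x ≼ w
≼-closed {w} {s} {x} rw d h = ≼-respʳ rw' rw e' (go (≼-respʳ rw rw' (sym e') h))
  where
  w' = nf (s ∷ w)
  e' : φ (s ∷ w') ≡ φ w
  e' = trans (cong (act s) (φ-nf (s ∷ w))) (act-involutive s (φ w))
  rw' : Reduced (s ∷ w')
  rw' = Reduced-cons (nf-reduced (s ∷ w)) (λ d' → ¬Desc-act s d (subst (Desc s) (φ-nf (s ∷ w)) d'))
  go : x ≼ s ∷ w' → s ∷ x ≼ s ∷ w'
  go (sub v (_ ∷ʳ p) e) = sub (s ∷ v) (refl ∷ p) (cong (act s) e)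
  go (sub (_ ∷ v) (refl ∷ p) e) = sub v (s ∷ʳ p) (trans (sym (act-involutive s (φ v))) (cong (act s) e))

-- Transversals of the index set of the recursion

_≈?_ : ∀ x y → Dec (x ≈ y)
x ≈? y = map′ (φ⇒≈ {x} {y}) ≈⇒φ (φ x ≟ᴬ φ y)
  where
  _≟ᴬ_ : ∀ m n → Dec (m ≡ n)
  alc i j k ≟ᴬ alc i' j' k' =
    map′ (λ { (refl , refl , refl) → refl }) (λ { refl → refl , refl , refl })
         (i ℤ.≟ i' ×-dec j ℤ.≟ j' ×-dec k ℤ.≟ k')

subwords : Word → List Word
subwords []      = [] ∷ []
subwords (s ∷ w) = subwords w ++ map (s ∷_) (subwords w)

⊆⇒∈subwords : v ⊆ w → v ∈ subwords w
⊆⇒∈subwords []         = here refl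
⊆⇒∈subwords (_ ∷ʳ p)   = ∈-++⁺ˡ (⊆⇒∈subwords p)
⊆⇒∈subwords {w = s ∷ w} (refl ∷ p) = ∈-++⁺ʳ (subwords w) (∈-map⁺ (s ∷_) (⊆⇒∈subwords p))

≼⇒<B : Reduced w → x ≼ w → φ x ≢ φ w → x <B w
≼⇒<B r h ne = ≼⇒≤B r h , λ e → ne (≈⇒φ e)

corrIdx : Reduced v → Reduced z → z ≼ v → φ z ≢ φ v → Desc s (φ z) → CorrIdx s v z
corrIdx {z = z} {s = s} rv rz h ne d = rz , ≼⇒<B rv h ne , Desc⇒InL z s d

CorrIdx⇒≼ : Reduced v → CorrIdx s v z → z ≼ v
CorrIdx⇒≼ rv (_ , (h , _) , _) = ≤B⇒≼ rv h

CorrIdx⇒Desc : CorrIdx s v z → Desc s (φ z)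
CorrIdx⇒Desc {s} {z = z} (_ , _ , h) = InL⇒Desc z s h

CorrIdx⇒< : Reduced v → CorrIdx s v z → length z < length v
CorrIdx⇒< {v} {s} {z} rv C@(rz , (_ , ne) , _) = ℕ.≤∧≢⇒<
  (subst (_≤ length v) (Reduced⇒ℓ rz) (≼-ℓ (CorrIdx⇒≼ rv C)))
  (λ e → ne (φ⇒≈ {z} {v} (≼-antisym (CorrIdx⇒≼ rv C) (ℕ.≤-reflexive (trans (sym e) (sym (Reduced⇒ℓ rz)))))))

corrIdx? : ∀ s → Reduced v → ∀ z → Dec (CorrIdx s v (nf z))
corrIdx? {v} s rv z = map′
  (λ { (h , ne , d) → corrIdx rv (nf-reduced z) h (λ e → ne (φ⇒≈ {nf z} {v} e)) d })
  (λ C → CorrIdx⇒≼ rv C , proj₂ (proj₁ (proj₂ C)) , CorrIdx⇒Desc C)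
  (nf z ≼? v ×-dec ¬? (nf z ≈? v) ×-dec desc? s (φ (nf z)))

-- The recursion can be applied only once a transversal is given. Normal forms of subwords of v
-- represent all elements below v; those in the index set are kept, without repetition.
transversal : ∀ s → Reduced v → Σ (List Word) (Transversal (CorrIdx s v))
transversal {v} s rv with gather (subwords v)
  where
  gather : ∀ l → Σ (List Word) λ Z → All (CorrIdx s v) Z
           × (∀ x → x ∈ l → CorrIdx s v (nf x) → Any (nf x ≈_) Z)
           × AllPairs (λ a b → ¬ (a ≈ b)) Z
  gather [] = [] , [] , (λ _ ()) , []
  gather (y ∷ l) with gather l | corrIdx? s rv y
  ... | Z , all , cov , dis | no ¬C = Z , all , (λ { x (here refl) C → ⊥-elim (¬C C) ; x (there i) C → cov x i C }) , dis
  ... | Z , all , cov , dis | yes C with Any.any? (nf y ≈?_) Z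
  ...   | yes i = Z , all , (λ { x (here refl) _ → i ; x (there i) C → cov x i C }) , dis
  ...   | no ¬i = nf y ∷ Z , C ∷ all , (λ { x (here refl) _ → here ε ; x (there i) C → there (cov x i C) }) , ¬Any⇒All¬ Z ¬i ∷ dis
... | Z , all , cov , dis = Z , all , cov' , dis
  where
  cov' : ∀ z → CorrIdx s v z → Any (z ≈_) Z
  cov' z C@(rz , (_ , ne) , _) with CorrIdx⇒≼ rv C
  ... | sub y p e = Any.map (z≈nf ◅◅_) (cov y (⊆⇒∈subwords p)
          (corrIdx rv (nf-reduced y) (≼-respˡ {y} (sym (φ-nf y)) (⊆⇒≼ p))
             (λ h → ne (φ⇒≈ {z} {v} (trans (sym (trans (φ-nf y) e)) h)))
             (subst (Desc s) (sym (trans (φ-nf y) e)) (CorrIdx⇒Desc C))))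
    where
    z≈nf : z ≈ nf y
    z≈nf = φ⇒≈ {z} {nf y} (sym (trans (φ-nf y) e))

sum-zero : ∀ (f : Word → ℤ) {Z} → All (λ z → f z ≡ 0ℤ) Z → sumℤ (map f Z) ≡ 0ℤ
sum-zero f []      = refl
sum-zero f (e ∷ h) rewrite e | sum-zero f h = refl

sum-one : ∀ (f : Word → ℤ) y {Z} → Any (y ≈_) Z → AllPairs (λ a b → ¬ (a ≈ b)) Z →
          All (λ z → (z ≈ y → f z ≡ 1ℤ) × (¬ (z ≈ y) → f z ≡ 0ℤ)) Z → sumℤ (map f Z) ≡ 1ℤ
sum-one f y (here y≈z) (dis ∷ _) ((one , _) ∷ h)
  rewrite one (≈-sym y≈z)
        | sum-zero f (All.zipWith (λ { (z≉ , (_ , z)) → z (λ x≈y → z≉ (≈-sym (x≈y ◅◅ y≈z))) }) (dis , h)) = refl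
sum-one f y (there i) (dis ∷ ds) ((_ , zro) ∷ h)
  rewrite zro (λ z≈y → All.lookupWith (λ z≉ y≈ → z≉ (z≈y ◅◅ y≈)) dis i) | sum-one f y i ds h = refl

module KL (P : KLFamily) (K : IsKL P) where
  open IsKL K

  -- The normal form lets words such as `s ∷ x`, which need not be reduced, stand in the first
  -- argument.
  p : Word → Word → ℕ → ℤ
  p x w = P (nf x) w

  P≡p : Reduced x → Reduced w → ∀ k → P x w k ≡ p x w k
  P≡p {x} rx rw = respects _ _ _ _ rx (nf-reduced x) rw rw (≈-nf x) ε

  p-vanish : Reduced w → ¬ (x ≼ w) → ∀ k → p x w k ≡ 0ℤ
  p-vanish {x = x} rw h = vanish _ _ (nf-reduced x) rw λ q → h (≼-respˡ {nf x} (φ-nf x) (≤B⇒≼ rw q))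

  module Step {s v} (r : Reduced (s ∷ v)) (x : Word) (h : x ≼ s ∷ v) where
    rv : Reduced v
    rv = Reduced-tail r

    Z : List Word
    Z = proj₁ (transversal s rv)

    Z-transversal : Transversal (CorrIdx s v) Z
    Z-transversal = proj₂ (transversal s rv)

    ρ : ℕ → ℤ
    ρ = corr P s v (nf x) Z

    h' : nf x ≤B (s ∷ v)
    h' = ≼⇒≤B r (≼-respˡ {x} (sym (φ-nf x)) h)

    sx≈ : nf (s ∷ x) ≈ (s ∷ nf x)
    sx≈ = φ⇒≈ {nf (s ∷ x)} {s ∷ nf x} (trans (φ-nf (s ∷ x)) (sym (cong (act s) (φ-nf x))))

    down : Desc s (φ x) → ∀ k → p x (s ∷ v) k ≡ (p (s ∷ x) v k ℤ.+ shift 1 (p x v) k) ℤ.- ρ k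
    down d = step-down s v (nf x) (nf (s ∷ x)) Z r (nf-reduced x) h'
      (Desc⇒InL (nf x) s (subst (Desc s) (sym (φ-nf x)) d)) (nf-reduced (s ∷ x)) sx≈ Z-transversal

    up : ¬ Desc s (φ x) → ∀ k → p x (s ∷ v) k ≡ (shift 1 (p (s ∷ x) v) k ℤ.+ p x v k) ℤ.- ρ k
    up ¬d = step-up s v (nf x) (nf (s ∷ x)) Z r (nf-reduced x) h'
      (λ i → ¬d (subst (Desc s) (φ-nf x) (InL⇒Desc (nf x) s i))) (nf-reduced (s ∷ x)) sx≈ Z-transversal

    term : Word → ℕ → ℤ
    term z k = μ P z v ℤ.* shift ⌊ (length (s ∷ v) ∸ length z) /2⌋ (P (nf x) z) k

    -- Here `d` is l(v) - l(z) - 1, so the shift (d + 2)/2 is at least one. Hence corrections have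
    -- no constant term.
    term≡ : ∀ z d k → length v ≡ suc (length z ℕ.+ d) →
            term z k ≡ (if isOdd (suc d) then P z v ⌊ d /2⌋ else 0ℤ) ℤ.* shift (suc ⌊ d /2⌋) (P (nf x) z) k
    term≡ z d k e
      rewrite e | ℕ.+-∸-assoc 1 (ℕ.m≤m+n (length z) d) | ℕ.+-∸-assoc 2 (ℕ.m≤m+n (length z) d)
            | ℕ.m+n∸m≡n (length z) d = refl

    excess : ∀ {z} → CorrIdx s v z → ∃ λ d → length v ≡ suc (length z ℕ.+ d)
    excess C with ℕ.m≤n⇒∃[o]m+o≡n (CorrIdx⇒< rv C)
    ... | d , e = d , sym e

    ρ₀ : ρ 0 ≡ 0ℤ
    ρ₀ = sum-zero _ (All.map (λ {z} C → let d , e = excess C in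
           trans (term≡ z d 0 e) (ℤ.*-zeroʳ (if isOdd (suc d) then P z v ⌊ d /2⌋ else 0ℤ))) (proj₁ Z-transversal))

    -- At distance two, μ vanishes by parity; from distance three on, the shift is at least two and
    -- misses the coefficient of q.
    term-far : ∀ z d → length v ≡ suc (length z ℕ.+ suc d) → term z 1 ≡ 0ℤ
    term-far z zero    e = term≡ z 1 1 e
    term-far z (suc d) e = trans (term≡ z (suc (suc d)) 1 e) (ℤ.*-zeroʳ (if isOdd (3 ℕ.+ d) then P z v ⌊ suc (suc d) /2⌋ else 0ℤ))

    term-near : ∀ z → length v ≡ suc (length z) → term z 1 ≡ P z v 0 ℤ.* P (nf x) z 0
    term-near z e = term≡ z 0 1 (trans e (cong suc (sym (ℕ.+-identityʳ (length z)))))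

  -- At degree 0 only the summand without a factor q survives, and lifting shows that its first
  -- index lies below v.
  p₀ : Reduced w → x ≼ w → p x w 0 ≡ 1ℤ
  p₀ {[]} {x} r h = trans (base (nf x) (nf-reduced x) 0) (cong (λ y → δe y 0) nf≡[])
    where
    nf≡[] : nf x ≡ []
    nf≡[] = cong (λ m → wordOf (len m) m) {φ x} {origin} (len≡0 (ℕ.n≤0⇒n≡0 (≼-ℓ h)))
  p₀ {s ∷ v} {x} r h with desc? s (φ x)
  ... | yes d = trans (down d 0) (trans (cong₂ (λ i j → i ℤ.+ 0ℤ ℤ.- j) (p₀ rv (≼-down s x h d)) ρ₀) refl)
    where open Step r x h
  ... | no ¬d = trans (up ¬d 0) (cong₂ (λ i j → 0ℤ ℤ.+ i ℤ.- j) (p₀ rv (≼-up s x h ¬d)) ρ₀)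
    where open Step r x h

  -- At degree 1 the correction counts the coatoms z of v with sz < z and x ≤ z: each contributes 1,
  -- every other index 0.
  module Corr {s v} (r : Reduced (s ∷ v)) (x : Word) (h : x ≼ s ∷ v) where
    open Step r x h public

    near-one : ∀ {z} → CorrIdx s v z → length v ≡ suc (length z) → x ≼ z → term z 1 ≡ 1ℤ
    near-one {z} C e q = trans (term-near z e)
      (cong₂ ℤ._*_ (trans (P≡p (proj₁ C) rv 0) (p₀ rv (CorrIdx⇒≼ rv C))) (p₀ (proj₁ C) q))

    other-zero : ∀ {z} → CorrIdx s v z → ¬ (length v ≡ suc (length z) × x ≼ z) → term z 1 ≡ 0ℤ
    other-zero {z} C n with excess C
    ... | suc d , e = term-far z d e
    ... | zero  , e = trans (term-near z e') (trans (cong (P z v 0 ℤ.*_) (p-vanish (proj₁ C) (λ q → n (e' , q)) 0)) (ℤ.*-zeroʳ (P z v 0)))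
      where
      e' : length v ≡ suc (length z)
      e' = trans e (cong suc (ℕ.+-identityʳ (length z)))

    corr-none : (∀ {z} → CorrIdx s v z → length v ≡ suc (length z) → ¬ (x ≼ z)) → ρ 1 ≡ 0ℤ
    corr-none n = sum-zero _ (All.map (λ C → other-zero C λ { (e , q) → n C e q }) (proj₁ Z-transversal))

    corr-one : CorrIdx s v y → length v ≡ suc (length y) → x ≼ y →
               (∀ {z} → CorrIdx s v z → length v ≡ suc (length z) → x ≼ z → φ z ≡ φ y) → ρ 1 ≡ 1ℤ
    corr-one {y} C e q uniq =
      sum-one _ y (proj₁ (proj₂ Z-transversal) y C) (proj₂ (proj₂ Z-transversal)) (All.map cases (proj₁ Z-transversal))
      where
      cases : ∀ {z} → CorrIdx s v z → (z ≈ y → term z 1 ≡ 1ℤ) × (¬ (z ≈ y) → term z 1 ≡ 0ℤ)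
      cases {z} C' =
        (λ z≈y → near-one C' (trans e (cong suc (trans (sym (Reduced⇒ℓ (proj₁ C)))
                   (trans (cong len (sym (≈⇒φ z≈y))) (Reduced⇒ℓ (proj₁ C'))))))
                   (≼-respʳ (proj₁ C) (proj₁ C') (sym (≈⇒φ z≈y)) q)) ,
        (λ z≉y → other-zero C' λ { (e' , q') → z≉y (φ⇒≈ {z} {y} (uniq C' e' q')) })

  private
    cancel-up : ∀ {A B i j : ℤ} → A ≡ (i ℤ.+ B) ℤ.- j → i ≡ j → A ≡ B
    cancel-up {B = B} {i} refl refl = trans (cong (ℤ._- i) (ℤ.+-comm i B)) (trans (ℤ.+-assoc B i (ℤ.- i))
      (trans (cong (λ k → B ℤ.+ k) (ℤ.+-inverseʳ i)) (ℤ.+-identityʳ B)))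

  -- A coatom z of v with sz < z above x is also above sx, and the length bound makes it equal to
  -- sx. The correction is thus 1 if sx ≤ v and 0 otherwise, which cancels the constant term of
  -- P_{sx,v}.
  p₁-up : Reduced (s ∷ v) → x ≼ s ∷ v → ¬ Desc s (φ x) → length v ≤ suc (suc (ℓ x)) →
          p x (s ∷ v) 1 ≡ p x v 1
  p₁-up {s} {v} {x} r h ¬d le = cancel-up (up ¬d 1) eq
    where
    open Corr r x h
    ℓsx : ℓ (s ∷ x) ≡ suc (ℓ x)
    ℓsx = len-asc s ¬d
    above : ∀ {z} → CorrIdx s v z → length v ≡ suc (length z) → x ≼ z → φ (s ∷ x) ≡ φ z
    above C e q = ≼-antisym {s ∷ x} (≼-closed (proj₁ C) (CorrIdx⇒Desc C) q)
                    (ℕ.≤-trans (ℕ.s≤s⁻¹ (subst (_≤ _) e le)) (ℕ.≤-reflexive (sym ℓsx)))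
    eq : p (s ∷ x) v 0 ≡ ρ 1
    eq with s ∷ x ≼? v
    ... | no n  = trans (p-vanish {x = s ∷ x} rv n 0) (sym (corr-none λ {z} C e q → n (≼-respˡ {z} (sym (above C e q)) (CorrIdx⇒≼ rv C))))
    ... | yes q = trans (p₀ {x = s ∷ x} rv q) (sym (corr-one {y = s ∷ nf x} C len≡ (sub (nf x) (s ∷ʳ ⊆-refl) (φ-nf x))
                    λ C' e' q' → trans (sym (above C' e' q')) (sym φy)))
      where
      φy : φ (s ∷ nf x) ≡ φ (s ∷ x)
      φy = cong (act s) (φ-nf x)
      ne : φ (s ∷ x) ≢ φ v
      -- Only sx has the descent `s`, so it differs from v, and the length bound makes it a coatom.
      ne e = Reduced⇒¬Desc r (subst (Desc s) e (Desc-act s ¬d))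
      lt : suc (ℓ x) < length v
      lt = ℕ.≰⇒> λ ge → ne (≼-antisym {s ∷ x} q (ℕ.≤-trans ge (ℕ.≤-reflexive (sym ℓsx))))
      len≡ : length v ≡ suc (length (s ∷ nf x))
      len≡ = trans (ℕ.≤-antisym le lt) (cong (λ k → suc (suc k)) (sym (length-nf x)))
      C : CorrIdx s v (s ∷ nf x)
      C = corrIdx rv (ℓ⇒Reduced (trans (cong len φy) (trans ℓsx (cong suc (sym (length-nf x))))))
            (≼-respˡ {s ∷ x} (sym φy) q) (λ e → ne (trans (sym φy) e)) (subst (Desc s) (sym φy) (Desc-act s ¬d))

  -- If `s` is a descent of x, the only coatom to count is x itself, which cancels the constant term
  -- of P_{x,v}; what remains is P_{sx,v}, again of colength at most two.
  p₁-colength≤2 : Reduced w → length w ≤ suc (suc (ℓ x)) → p x w 1 ≡ 0ℤ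
  p₁-colength≤2 {[]} {x} r le = trans (base (nf x) (nf-reduced x) 1) (δe₁ (nf x))
    where
    δe₁ : ∀ y → δe y 1 ≡ 0ℤ
    δe₁ []      = refl
    δe₁ (_ ∷ _) = refl
  p₁-colength≤2 {s ∷ v} {x} r le with x ≼? s ∷ v
  ... | no n = p-vanish {x = x} r n 1
  ... | yes h with desc? s (φ x)
  ...   | no ¬d = trans (p₁-up r h ¬d (ℕ.≤-trans (ℕ.n≤1+n _) le)) (p₁-colength≤2 {x = x} (Reduced-tail r) (ℕ.≤-trans (ℕ.n≤1+n _) le))
  ...   | yes d = trans (cancel-up (trans (down d 1) (cong (ℤ._- ρ 1) (ℤ.+-comm (p (s ∷ x) v 1) (p x v 0)))) eq)
                    (p₁-colength≤2 {x = s ∷ x} rv (subst (λ k → length v ≤ suc k) (len-desc s d) le'))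
    where
    open Corr r x h
    le' : length v ≤ suc (ℓ x)
    le' = ℕ.s≤s⁻¹ le
    above : ∀ {z} → CorrIdx s v z → length v ≡ suc (length z) → x ≼ z → φ x ≡ φ z
    above C e q = ≼-antisym q (ℕ.s≤s⁻¹ (subst (_≤ _) e le'))
    eq : p x v 0 ≡ ρ 1
    eq with x ≼? v
    ... | no n  = trans (p-vanish rv n 0) (sym (corr-none λ {z} C e q → n (≼-respˡ {z} (sym (above C e q)) (CorrIdx⇒≼ rv C))))
    ... | yes q = trans (p₀ rv q) (sym (corr-one {y = nf x} C len≡ (sub (nf x) ⊆-refl (φ-nf x))
                    λ C' e' q' → trans (sym (above C' e' q')) (sym (φ-nf x))))
      where
      ne : φ x ≢ φ v
      ne e = Reduced⇒¬Desc r (subst (Desc s) e d)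
      len≡ : length v ≡ suc (length (nf x))
      len≡ = trans (ℕ.≤-antisym le' (ℕ.≰⇒> λ ge → ne (≼-antisym q ge))) (cong suc (sym (length-nf x)))
      C : CorrIdx s v (nf x)
      C = corrIdx rv (nf-reduced x) (≼-respˡ {x} (sym (φ-nf x)) q) (λ e → ne (trans (sym (φ-nf x)) e)) (subst (Desc s) (sym (φ-nf x)) d)

-- Spirals: the elements of c₁

spiral : S → S → S → ℕ → Word
spiral a b c zero    = []
spiral a b c (suc k) = a ∷ spiral b c a k

-- Position k, counted from zero, of abcabc⋯. By periodicity, `letter c a b k` and `letter b c a k`
-- are the last and the penultimate letter of a spiral of length k ≥ 2.
letter : S → S → S → ℕ → S
letter a b c zero    = a
letter a b c (suc k) = letter b c a k

length-spiral : ∀ a b c k → length (spiral a b c k) ≡ k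
length-spiral a b c zero    = refl
length-spiral a b c (suc k) = cong suc (length-spiral b c a k)

spiral-++ : ∀ a b c j i → spiral a b c (j ℕ.+ i) ≡ spiral a b c j ++ spiral (letter a b c j) (letter b c a j) (letter c a b j) i
spiral-++ a b c zero    i = refl
spiral-++ a b c (suc j) i = cong (a ∷_) (spiral-++ b c a j i)

spiral-snoc : ∀ a b c j → spiral a b c (suc j) ≡ spiral a b c j ++ letter a b c j ∷ []
spiral-snoc a b c j = trans (cong (spiral a b c) (ℕ.+-comm 1 j)) (spiral-++ a b c j 1)

Tri-letter : Tri a b c → ∀ j → Tri (letter a b c j) (letter b c a j) (letter c a b j)
Tri-letter T zero    = T
Tri-letter T (suc j) = Tri-letter (rotate T) j

reverse-spiral : ∀ a b c k → reverse (spiral a b c k) ≡ spiral (letter c a b k) (letter b c a k) (letter a b c k) k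
reverse-spiral a b c zero    = refl
reverse-spiral a b c (suc k) =
  trans (cong reverse (spiral-snoc a b c k))
    (trans (reverse-snoc (spiral a b c k) (letter a b c k)) (cong (letter a b c k ∷_) (reverse-spiral a b c k)))

coord-origin : ∀ i → coord origin i ≡ 0ℤ
coord-origin 0F = refl
coord-origin 1F = refl
coord-origin 2F = refl

-- Up to sign, coordinate `b` is coordinate `c` of the tail, and c is the second letter there.
coord-spiral₂ : Tri a b c → ∀ k → coord (φ (spiral a b c k)) b ≡ 0ℤ
coord-spiral₂ {b = b} T zero = coord-origin b
coord-spiral₂ T (suc k) = trans (coord-act≢ T _) (cong ℤ.-_ (coord-spiral₂ (rotate T) k))

spiral-¬second : Tri a b c → ∀ k → ¬ Desc b (φ (spiral a b c k))
spiral-¬second T k d with subst Neg (coord-spiral₂ T k) d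
... | ()

-- Mutual induction: prefixing `a` ascends because a is the third letter for the tail, and
-- coordinate `c` is positive because the tail has its first letter `b` as a descent.
spiral-first : Tri a b c → ∀ k → Desc a (φ (spiral a b c (suc k)))
spiral-third : Tri a b c → ∀ k → Pos (coord (φ (spiral a b c (suc (suc k)))) c)
spiral-¬third : Tri a b c → ∀ k → ¬ Desc c (φ (spiral a b c k))

spiral-first {a} T k = Desc-act a (spiral-¬third (rotate T) k)

spiral-third T k = subst Pos (sym (coord-act≢ (swap₂₃ T) _)) (Neg⇒Pos- (spiral-first (rotate T) k))

spiral-¬third {c = c} T zero = ¬Desc-[] c
spiral-¬third {b = b} T (suc zero) d
  with subst Neg (trans (coord-act≢ (swap₂₃ T) origin) (cong ℤ.-_ (coord-origin b))) d
... | ()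
spiral-¬third T (suc (suc k)) = Pos⇒¬Neg (spiral-third T k)

spiral-reduced : Tri a b c → ∀ k → Reduced (spiral a b c k)
spiral-reduced T zero    = ℓ⇒Reduced refl
spiral-reduced T (suc k) = Reduced-cons (spiral-reduced (rotate T) k) (spiral-¬third (rotate T) k)

ℓ-spiral : Tri a b c → ∀ k → ℓ (spiral a b c k) ≡ k
ℓ-spiral {a} {b} {c} T k = trans (Reduced⇒ℓ (spiral-reduced T k)) (length-spiral a b c k)

spiral-antisym : ∀ a b c k → x ≼ spiral a b c k → ℓ x ≡ k → φ x ≡ φ (spiral a b c k)
spiral-antisym a b c k h e = ≼-antisym h (ℕ.≤-reflexive (trans (length-spiral a b c k) (sym e)))

-- Prefixing `b` turns the positive coordinate `c` into a negative coordinate `a`. This is the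
-- source of the second descent of every folded element.
spiral-prefix-second : Tri a b c → ∀ k → Desc a (φ (b ∷ spiral a b c (suc (suc k))))
spiral-prefix-second T k = subst Neg (sym (coord-act≢ (swap₁₂ T) _)) (Pos⇒Neg- (spiral-third T k))

φ-cancel : ∀ s x → φ (s ∷ x) ≡ φ y → φ x ≡ φ (s ∷ y)
φ-cancel s x e = trans (sym (act-involutive s (φ x))) (cong (act s) e)

ℓ-desc : ∀ s x {k} → Desc s (φ x) → ℓ x ≡ suc k → ℓ (s ∷ x) ≡ k
ℓ-desc s x d e = ℕ.suc-injective (trans (sym (len-desc s d)) e)

-- If `a` were not a descent, x would be bca⋯, which has no descent c. So x can be lowered by a, and
-- the descent c then excludes b, leaving ax below cab⋯ of the same length.
coatom-third : Tri a b c → ∀ k x → x ≼ spiral a b c (suc (suc k)) → ℓ x ≡ suc k → Desc c (φ x) →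
               φ x ≡ φ (a ∷ spiral c a b k)
coatom-third {a} {b} {c} T k x h e d with desc? a (φ x)
... | no ¬a = ⊥-elim (spiral-¬second (rotate T) (suc k) (subst (Desc c) (spiral-antisym b c a (suc k) (≼-up a x h ¬a) e) d))
... | yes da = φ-cancel {spiral c a b k} a x
      (spiral-antisym c a b k (≼-up b (a ∷ x) (≼-down a x h da) (no-third-descent (swap₂₃ T) d)) (ℓ-desc a x da e))

-- x is the spiral of length k with its penultimate letter deleted, and also equals b·abcabc⋯;
-- the two agree only when k is even, which is why both equations are recorded.
Folded : S → S → S → ℕ → Word → Set
Folded a b c k x = Σ ℕ λ j → k ≡ 4 ℕ.+ j
  × φ x ≡ φ (b ∷ spiral a b c (suc (suc j)))
  × φ x ≡ φ (spiral a b c (suc (suc j)) ++ letter a b c j ∷ [])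

-- If `a` is a descent too, then bax is a coatom of cab⋯ with descent a, again the second letter,
-- and induction applies to a spiral shorter by two.
coatom-second : Tri a b c → ∀ k x → x ≼ spiral a b c k → suc (ℓ x) ≡ k → Desc b (φ x) →
                φ x ≡ φ (spiral b c a (pred k)) ⊎ Folded a b c k x
coatom-second {b = b} T (suc zero) x h e d =
  ⊥-elim (¬Desc-[] b (subst (Desc b) (len≡0 (ℕ.suc-injective e)) d))
coatom-second {a} {b} {c} T (suc (suc k)) x h e d with desc? a (φ x)
... | no ¬a = inj₁ (spiral-antisym b c a (suc k) (≼-up a x h ¬a) (ℕ.suc-injective e))
... | yes da = go k ℓbax (coatom-second (rotate (rotate T)) k (b ∷ a ∷ x) h₂ ℓbax da₃)
  where
  db₂ : Desc b (φ (a ∷ x))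
  db₂ = dihedral₂ T (φ-isAlcove x) da d
  h₂ : b ∷ a ∷ x ≼ spiral c a b k
  h₂ = ≼-down b (a ∷ x) (≼-down a x h da) db₂
  da₃ : Desc a (φ (b ∷ a ∷ x))
  da₃ = dihedral₃ T {φ x} d
  ℓbax : suc (ℓ (b ∷ a ∷ x)) ≡ k
  ℓbax = trans (sym (len-desc b db₂)) (ℓ-desc a x da (ℕ.suc-injective e))
  unfold : ∀ y → φ (b ∷ a ∷ x) ≡ φ y → φ x ≡ φ (a ∷ b ∷ y)
  unfold y e = φ-cancel {b ∷ y} a x (φ-cancel {y} b (a ∷ x) e)
  go : ∀ k → suc (ℓ (b ∷ a ∷ x)) ≡ k → φ (b ∷ a ∷ x) ≡ φ (spiral a b c (pred k)) ⊎ Folded c a b k (b ∷ a ∷ x) →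
       φ x ≡ φ (spiral b c a (suc k)) ⊎ Folded a b c (suc (suc k)) x
  go (suc zero) _ (inj₁ e) = ⊥-elim (¬Desc-[] a (subst (Desc a) e da₃))
  -- The shortest folded element: aba, which is abca with c deleted, equals bab.
  go (suc (suc zero)) _ (inj₁ e) =
    inj₂ (0 , refl , trans (unfold (a ∷ []) e) (act-braid T origin) , unfold (a ∷ []) e)
  -- Here ax would be b·abc⋯, which has the descent `a`.
  go (suc (suc (suc k))) _ (inj₁ e) =
    ⊥-elim (¬Desc-act a da (subst (Desc a) (sym (φ-cancel {spiral a b c (suc (suc k))} b (a ∷ x) e)) (spiral-prefix-second T k)))
  go _ _ (inj₂ (j , refl , e₁ , e₂)) =
    inj₂ (suc (suc j) , refl , trans (unfold (a ∷ spiral c a b (suc (suc j))) e₁) (act-braid T _) ,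
          unfold (spiral c a b (suc (suc j)) ++ letter c a b j ∷ []) e₂)

-- The coefficient of q below a spiral

module Spiral (P : KLFamily) (K : IsKL P) where
  open KL P K

  module _ (T : Tri a b c) (k : ℕ) where
    private
      v₀ z₀ : Word
      v₀ = spiral b c a (4 ℕ.+ k)
      z₀ = b ∷ spiral a b c (suc (suc k))
      rw : Reduced (a ∷ v₀)
      rw = spiral-reduced T (5 ℕ.+ k)
      rv₀ : Reduced v₀
      rv₀ = Reduced-tail rw

    z₀-reduced : Reduced (b ∷ spiral a b c (suc (suc k)))
    z₀-reduced = Reduced-cons (spiral-reduced T (suc (suc k))) (spiral-¬second T (suc (suc k)))

    z₀⊆ : b ∷ spiral a b c (suc (suc k)) ⊆ spiral b c a (4 ℕ.+ k)
    z₀⊆ = refl ∷ c ∷ʳ ⊆-refl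

    p₁-spiral : ∀ x → x ≼ spiral a b c (5 ℕ.+ k) → Desc a (φ x) →
                p x (spiral a b c (5 ℕ.+ k)) 1 ≡
                (p (a ∷ x) (spiral b c a (4 ℕ.+ k)) 1 ℤ.+ p x (spiral b c a (4 ℕ.+ k)) 0)
                  ℤ.- p x (b ∷ spiral a b c (suc (suc k))) 0
    p₁-spiral x h d = trans (down d 1) (cong (λ i → (p (a ∷ x) v₀ 1 ℤ.+ p x v₀ 0) ℤ.- i) eq)
      where
      open Corr rw x h
      uniq : ∀ {z} → CorrIdx a v₀ z → length v₀ ≡ suc (length z) → φ z ≡ φ z₀
      uniq {z} C e = coatom-third (rotate T) (suc (suc k)) z (CorrIdx⇒≼ rv₀ C)
        (ℕ.suc-injective (trans (cong suc (Reduced⇒ℓ (proj₁ C))) (trans (sym e) (length-spiral b c a _)))) (CorrIdx⇒Desc C)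
      ℓz₀ : ℓ z₀ ≡ suc (suc (suc k))
      ℓz₀ = trans (Reduced⇒ℓ z₀-reduced) (cong suc (length-spiral a b c (suc (suc k))))
      C₀ : CorrIdx a v₀ z₀
      C₀ = corrIdx rv₀ z₀-reduced (⊆⇒≼ z₀⊆)
             (λ e → ℕ.1+n≢n (trans (sym (ℓ-spiral (rotate T) (4 ℕ.+ k))) (trans (cong len (sym e)) ℓz₀)))
             (spiral-prefix-second T k)
      eq : ρ 1 ≡ p x z₀ 0
      eq with x ≼? z₀
      ... | yes q = trans (corr-one C₀ refl q (λ C e _ → uniq C e)) (sym (p₀ z₀-reduced q))
      ... | no n = trans (corr-none λ C e q → n (≼-respʳ (proj₁ C) z₀-reduced (uniq C e) q)) (sym (p-vanish z₀-reduced n 0))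

  p₁≢0⇒Desc : Tri a b c → ∀ n x → x ≼ spiral a b c (3 ℕ.+ n) → ℓ x ≡ n →
              p x (spiral a b c (3 ℕ.+ n)) 1 ≢ 0ℤ → Desc a (φ x)
  p₁≢0⇒Desc {a} {b} {c} T n x h e ne with desc? a (φ x)
  ... | yes d = d
  ... | no ¬d = ⊥-elim (ne (trans (p₁-up (spiral-reduced T _) h ¬d le) (p₁-colength≤2 {x = x} (spiral-reduced (rotate T) _) le)))
    where
    le : length (spiral b c a (suc (suc n))) ≤ suc (suc (ℓ x))
    le = ℕ.≤-reflexive (trans (length-spiral b c a (suc (suc n))) (cong (λ k → suc (suc k)) (sym e)))

  -- If P_{ax,v} contributes, `ih` makes ax a spiral, since a folded ax would have the descent a.
  -- Otherwise x ≤ v but not x ≤ z₀. A descent b of x would let bx be lifted past c, giving x ≤ z₀;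
  -- hence b is lifted past, and x is a coatom of cab⋯ with descent a.
  p₁≢0-step : Tri a b c → ∀ k x → x ≼ spiral a b c (5 ℕ.+ k) → ℓ x ≡ suc (suc k) → Desc a (φ x) →
              (p (a ∷ x) (spiral b c a (4 ℕ.+ k)) 1 ≢ 0ℤ →
                φ (a ∷ x) ≡ φ (spiral b c a (suc k)) ⊎ Folded a b c (suc (suc k)) (a ∷ x)) →
              p x (spiral a b c (5 ℕ.+ k)) 1 ≢ 0ℤ →
              φ x ≡ φ (spiral a b c (suc (suc k))) ⊎ Folded c a b (3 ℕ.+ k) x
  p₁≢0-step {a} {b} {c} T k x h e d ih ne with p (a ∷ x) (spiral b c a (4 ℕ.+ k)) 1 ℤ.≟ 0ℤ
  ... | no ne' with ih ne'
  ...   | inj₁ e' = inj₁ (φ-cancel {spiral b c a (suc k)} a x e')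
  ...   | inj₂ (j , _ , e₁ , _) = ⊥-elim (¬Desc-act a d (subst (Desc a) (sym e₁) (spiral-prefix-second T j)))
  p₁≢0-step {a} {b} {c} T k x h e d ih ne | yes e0 = go (x ≼? v₀) (x ≼? z₀)
    where
    v₀ z₀ : Word
    v₀ = spiral b c a (4 ℕ.+ k)
    z₀ = b ∷ spiral a b c (suc (suc k))
    rv₀ : Reduced v₀
    rv₀ = spiral-reduced (rotate T) _
    p₀≢ : p x v₀ 0 ≢ p x z₀ 0
    p₀≢ q = ne (trans (p₁-spiral T k x h d) (trans (cong₂ (λ i j → (i ℤ.+ j) ℤ.- p x z₀ 0) e0 q)
      (trans (cong (ℤ._- p x z₀ 0) (ℤ.+-identityˡ (p x z₀ 0))) (ℤ.+-inverseʳ (p x z₀ 0)))))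
    go : Dec (x ≼ v₀) → Dec (x ≼ z₀) → φ x ≡ φ (spiral a b c (suc (suc k))) ⊎ Folded c a b (3 ℕ.+ k) x
    go (no n)  (yes q)  = ⊥-elim (n (≼-⊆ q (z₀⊆ T k)))
    go (no n)  (no n')  = ⊥-elim (p₀≢ (trans (p-vanish rv₀ n 0) (sym (p-vanish (z₀-reduced T k) n' 0))))
    go (yes q) (yes q') = ⊥-elim (p₀≢ (trans (p₀ rv₀ q) (sym (p₀ (z₀-reduced T k) q'))))
    go (yes q) (no n') with desc? b (φ x)
    ... | yes db = ⊥-elim (n' (≼-respˡ {b ∷ b ∷ x} (act-involutive b (φ x)) (≼-cons b
                     (≼-up c (b ∷ x) (≼-down b x q db) (no-third-descent (swap₁₂ T) d)))))
    ... | no ¬b = coatom-second (rotate (rotate T)) (3 ℕ.+ k) x (≼-up b x q ¬b) (cong suc e) d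

  p₁≢0 : Tri a b c → ∀ n x → x ≼ spiral a b c (3 ℕ.+ n) → ℓ x ≡ n →
         p x (spiral a b c (3 ℕ.+ n)) 1 ≢ 0ℤ →
         φ x ≡ φ (spiral a b c n) ⊎ Folded c a b (suc n) x
  p₁≢0 T zero x h e ne = inj₁ (len≡0 e)
  p₁≢0 {a} T (suc zero) x h e ne = inj₁ (φ-cancel {[]} a x (len≡0 (ℓ-desc a x (p₁≢0⇒Desc T 1 x h e ne) e)))
  p₁≢0 {a} T (suc (suc k)) x h e ne =
    p₁≢0-step T k x h e d (p₁≢0 (rotate T) (suc k) (a ∷ x) (≼-down a x h d) (ℓ-desc a x d e)) ne
    where
    d : Desc a (φ x)
    d = p₁≢0⇒Desc T (suc (suc k)) x h e ne

-- The exceptional element of colength three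

delete-one : ∀ a b c k → v ⊆ spiral a b c k → suc (length v) ≡ k →
             Σ ℕ λ i → Σ ℕ λ j → k ≡ i ℕ.+ suc j ×
             v ≡ spiral a b c i ++ spiral (letter b c a i) (letter c a b i) (letter a b c i) j
delete-one a b c (suc k) (_ ∷ʳ p) e =
  0 , k , refl , ⊆-length≡ p (ℕ.≤-reflexive (trans (length-spiral b c a k) (sym (ℕ.suc-injective e))))
delete-one a b c (suc k) (refl ∷ p) e with delete-one b c a k p (ℕ.suc-injective e)
... | i , j , e' , q = suc i , j , cong suc e' , cong (a ∷_) q

φ-abab : Tri a b c → ∀ p r → φ ((p ++ a ∷ b ∷ []) ++ a ∷ b ∷ r) ≡ φ (p ++ b ∷ a ∷ r)
φ-abab {a} {b} T p r = trans (cong φ (++-assoc p (a ∷ b ∷ []) (a ∷ b ∷ r)))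
  (φ-++ p {a ∷ b ∷ a ∷ b ∷ r} {b ∷ a ∷ r}
    (trans (act-braid T (φ (b ∷ r))) (cong (λ m → act b (act a m)) (act-involutive b (φ r)))))

-- Deleting a letter with two letters on either side leaves a non-reduced factor abab, so a coatom
-- arises by deleting one of the first or last two letters, which shows in its descents.
coatom-interior : Tri a b c → ∀ k → x ≼ spiral a b c (suc (suc k)) → ℓ x ≡ suc k →
                  ¬ Desc b (φ x) → ¬ Desc c (φ x) →
                  ¬ Desc (letter a b c k) (φ (reverse x)) → ¬ Desc (letter c a b k) (φ (reverse x)) →
                  k ≡ 1 × φ x ≡ φ (a ∷ c ∷ [])
coatom-interior {a} {b} {c} {x} T k (sub v p e) ex ¬b ¬c ¬r₂ ¬r₃ with delete-one a b c (suc (suc k)) p (cong suc lv)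
  where
  lv : length v ≡ suc k
  lv = ℕ.≤-antisym
    (ℕ.≮⇒≥ λ gt → ℕ.1+n≢n (trans (trans (sym (ℓ-spiral T (suc (suc k))))
      (cong ℓ (sym (⊆-length≡ p (subst (_≤ length v) (sym (length-spiral a b c (suc (suc k)))) gt))))) (trans (cong len e) ex)))
    (subst (_≤ length v) (trans (cong len e) ex) (ℓ≤length v))
... | 0 , j , refl , refl = ⊥-elim (¬b (subst (Desc b) e (spiral-first (rotate T) k)))
... | suc i , 0 , ij , refl with trans (ℕ.+-comm 1 i) (sym (ℕ.suc-injective ij))
...   | refl = ⊥-elim (¬r₂ (subst (Desc (letter a b c k)) eq (spiral-first (mirror (Tri-letter T (suc k))) k)))
  where
  eq : φ (spiral (letter c a b (suc k)) (letter b c a (suc k)) (letter a b c (suc k)) (suc k)) ≡ φ (reverse x)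
  eq = trans (cong φ (trans (sym (reverse-spiral a b c (suc k))) (cong reverse (sym (++-identityʳ (spiral a b c (suc k)))))))
             (φ-reverse {spiral a b c (suc k) ++ []} {x} e)
-- The single exception: in abc the middle letter is both the second and the penultimate one.
coatom-interior {a} {b} {c} {x} T k (sub v p e) ex ¬b ¬c ¬r₂ ¬r₃ | 1 , suc zero , refl , refl = refl , sym e
coatom-interior {a} {b} {c} {x} T k (sub v p e) ex ¬b ¬c ¬r₂ ¬r₃ | 1 , suc (suc j) , refl , refl =
  ⊥-elim (¬c (subst (Desc c) e (spiral-prefix-second (rotate (rotate T)) j)))
coatom-interior {a} {b} {c} {x} T k (sub v p e) ex ¬b ¬c ¬r₂ ¬r₃ | suc (suc i) , 1 , ij , refl
  with trans (ℕ.suc-injective (ℕ.suc-injective ij)) (ℕ.+-comm i 2)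
... | refl = ⊥-elim (¬r₃ (subst (Desc (letter b c a i)) eq (spiral-prefix-second (swap₁₂ (Tri-letter T i)) i)))
  where
  eq : φ (letter a b c i ∷ spiral (letter b c a i) (letter a b c i) (letter c a b i) (suc (suc i))) ≡ φ (reverse x)
  eq = trans (cong φ (sym (trans (reverse-snoc (spiral a b c (suc (suc i))) (letter a b c i))
                           (cong (letter a b c i ∷_) (reverse-spiral a b c (suc (suc i)))))))
             (φ-reverse {spiral a b c (suc (suc i)) ++ letter a b c i ∷ []} {x} e)
coatom-interior {a} {b} {c} {x} T k (sub v p e) ex ¬b ¬c ¬r₂ ¬r₃ | suc (suc i) , suc (suc j) , ij , refl =
  ⊥-elim (ℕ.<-irrefl (trans (sym (cong len short)) (trans (cong len e) ex)) bound)
  where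
  r : Word
  r = spiral (letter c a b i) (letter a b c i) (letter b c a i) j
  short : φ (spiral a b c (suc (suc i)) ++ letter a b c i ∷ letter b c a i ∷ r) ≡
          φ (spiral a b c i ++ letter b c a i ∷ letter a b c i ∷ r)
  short = trans (cong (λ q → φ (q ++ letter a b c i ∷ letter b c a i ∷ r))
                  (trans (cong (spiral a b c) (ℕ.+-comm 2 i)) (spiral-++ a b c i 2)))
                (φ-abab (Tri-letter T i) (spiral a b c i) r)
  bound : ℓ (spiral a b c i ++ letter b c a i ∷ letter a b c i ∷ r) < suc k
  bound = ℕ.≤-<-trans (ℓ≤length (spiral a b c i ++ letter b c a i ∷ letter a b c i ∷ r))
    (subst₂ _<_ (sym (trans (length-++ (spiral a b c i))
                        (cong₂ (λ m n → m ℕ.+ suc (suc n)) (length-spiral a b c i)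
                          (length-spiral (letter c a b i) (letter a b c i) (letter b c a i) j))))
                (cong suc (sym (ℕ.suc-injective (ℕ.suc-injective ij))))
                (s≤s (ℕ.+-monoʳ-≤ i (ℕ.n≤1+n (suc (suc j))))))

fold-end : Tri a b c → ∀ j u → u ≼ spiral a b c (6 ℕ.+ j) → ℓ u ≡ suc (suc (suc j)) →
           Desc a (φ u) → Desc c (φ u) →
           Desc (letter a b c j) (φ (reverse u)) → Desc (letter c a b j) (φ (reverse u)) →
           φ u ≡ φ (spiral c a b (suc (suc j)) ++ letter c a b j ∷ [])
fold-end {a} {b} {c} T j u h eu da dc dx dz = trans (sym undo) (φ-++ʳ {x₀} {spiral c a b (suc (suc j))} (γ ∷ []) φx₀)
  where
  α β γ : S
  α = letter a b c j
  β = letter b c a j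
  γ = letter c a b j
  TR : Tri α β γ
  TR = Tri-letter T j
  ū x₀ : Word
  ū = reverse u
  x₀ = u ++ γ ∷ []
  undo : φ (x₀ ++ γ ∷ []) ≡ φ u
  undo = trans (cong φ (∷ʳ-++ u γ (γ ∷ []))) (trans (φ-++ u {γ ∷ γ ∷ []} {[]} (act-involutive γ origin)) (cong φ (++-identityʳ u)))
  ¬β : ¬ Desc β (φ (γ ∷ ū))
  ¬β = no-third-descent (rotate (rotate TR)) dx
  hū : γ ∷ ū ≼ spiral α γ β (4 ℕ.+ j)
  hū = ≼-up β (γ ∷ ū) (≼-down γ ū (subst (ū ≼_) (reverse-spiral a b c (6 ℕ.+ j)) (≼-reverse h)) dz) ¬β
  reverse-x₀ : reverse x₀ ≡ γ ∷ ū
  reverse-x₀ = reverse-snoc u γ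
  h₀ : x₀ ≼ spiral a b c (4 ℕ.+ j)
  h₀ = subst₂ _≼_ (trans (cong reverse (sym reverse-x₀)) (reverse-involutive x₀))
         (trans (cong reverse (sym (reverse-spiral a b c (4 ℕ.+ j)))) (reverse-involutive _)) (≼-reverse hū)
  ℓx₀ : ℓ x₀ ≡ suc (suc j)
  ℓx₀ = trans (ℓ-snoc u γ) (ℓ-desc γ ū dz (trans (ℓ-reverse u) eu))
  ¬b₀ : ¬ Desc b (φ x₀)
  ¬b₀ d = no-three-descents (swap₂₃ T) (φ-isAlcove u) da dc (Desc-snoc b u dz d)
  ¬a₀ : ¬ Desc a (φ x₀)
  -- A descent a would make ax₀ a coatom of cab⋯ with none of the descents that deletions near
  -- either end produce. The exception gives u = acba, which lacks the left descent c.
  ¬a₀ d₀ = acba (coatom-interior (rotate (rotate T)) j hZ (ℓ-desc a x₀ d₀ ℓx₀) (¬Desc-act a d₀) ¬bZ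
                (λ d → ¬Desc-act γ dz (reverse-Z γ d)) (λ d → ¬β (reverse-Z β d)))
    where
    ¬bZ : ¬ Desc b (φ (a ∷ x₀))
    ¬bZ d = no-third-descent (swap₂₃ T) dc (Desc-snoc b (a ∷ u) dz' d)
      where
      dz' : Desc γ (φ (reverse (a ∷ u)))
      dz' with desc? γ (φ (reverse (a ∷ u)))
      ... | yes q = q
      ... | no n  = ⊥-elim (ℕ.<-irrefl (trans (sym (ℓ-desc a x₀ d₀ ℓx₀))
                      (trans (ℓ-snoc (a ∷ u) γ) (trans (len-asc γ n) (cong suc (trans (ℓ-reverse (a ∷ u)) (ℓ-desc a u da eu))))))
                      (ℕ.m≤n⇒m≤1+n (ℕ.n<1+n (suc j))))
    hZ : a ∷ x₀ ≼ spiral c a b (suc (suc j))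
    hZ = ≼-up b (a ∷ x₀) (≼-down a x₀ h₀ d₀) ¬bZ
    reverse-Z : ∀ σ → Desc σ (φ (reverse (a ∷ x₀))) → Desc σ (φ (γ ∷ ū))
    reverse-Z σ d = subst (λ q → Desc σ (φ q)) reverse-x₀
      (Desc-snoc σ (reverse x₀) (subst (λ q → Desc a (φ q)) (sym (reverse-involutive x₀)) d₀)
        (subst (λ q → Desc σ (φ q)) (reverse-++ (a ∷ []) x₀) d))
    acba : j ≡ 1 × φ (a ∷ x₀) ≡ φ (c ∷ b ∷ []) → ⊥
    acba (j≡1 , e) = spiral-¬second (swap₂₃ T) 4 (subst (Desc c)
      (trans (sym undo) (trans (φ-++ʳ {x₀} {a ∷ c ∷ b ∷ []} (γ ∷ []) (φ-cancel {c ∷ b ∷ []} a x₀ e))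
        (cong (λ k → φ (a ∷ c ∷ b ∷ letter c a b k ∷ [])) j≡1))) dc)
  φx₀ : φ x₀ ≡ φ (spiral c a b (suc (suc j)))
  φx₀ = spiral-antisym c a b (suc (suc j)) (≼-up b x₀ (≼-up a x₀ h₀ ¬a₀) ¬b₀) ℓx₀

-- Elements of c₀ and c₁ as words

spiral-unique : Tri a b c → ∀ k x → Reduced x → φ x ≡ φ (spiral a b c k) → x ≡ spiral a b c k
spiral-unique T zero    []      r e = refl
spiral-unique T zero    (s ∷ x) r e = ⊥-elim (¬Desc-[] s (subst (Desc s) e (Reduced⇒Desc r)))
spiral-unique {a} T (suc k) [] r e  = ⊥-elim (¬Desc-[] a (subst (Desc a) (sym e) (spiral-first T k)))
spiral-unique {a} T (suc k) (s ∷ x) r e with Tri-cover T s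
... | inj₁ refl        = cong (a ∷_) (spiral-unique (rotate T) k x (Reduced-tail r) (act-injective a e))
... | inj₂ (inj₁ refl) = ⊥-elim (spiral-¬second T (suc k) (subst (Desc s) e (Reduced⇒Desc r)))
... | inj₂ (inj₂ refl) = ⊥-elim (spiral-¬third T (suc k) (subst (Desc s) e (Reduced⇒Desc r)))

C0⇒¬spiral : InC0 u → Tri a b c → ∀ k → φ u ≢ φ (spiral a b c k)
C0⇒¬spiral {u} (ru , ne , ¬C1) T k e = ¬C1 (ru , ne , λ w' rw' w'≈u →
  trans (spiral-unique T k w' rw' (trans (≈⇒φ w'≈u) e)) (sym (spiral-unique T k u ru e)))

others : ∀ a → Σ S λ b → Σ S λ c → Tri a b c
others 0F = 1F , 2F , t012
others 1F = 2F , 0F , t120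
others 2F = 0F , 1F , t201

C0-length : InC0 u → Σ ℕ λ j → length u ≡ suc (suc (suc j))
C0-length {[]} C = ⊥-elim (C0⇒¬spiral C t012 0 refl)
C0-length {a ∷ []} C = ⊥-elim (C0⇒¬spiral C (proj₂ (proj₂ (others a))) 1 refl)
C0-length {a ∷ b ∷ []} C with a ≟ b
... | no ne    = ⊥-elim (C0⇒¬spiral C (proj₂ (third a b ne)) 2 refl)
... | yes refl = ⊥-elim (Reduced⇒¬Desc (proj₁ C) (Reduced⇒Desc (Reduced-tail (proj₁ C))))
C0-length {a ∷ b ∷ c ∷ m} C = length m , refl

-- Membership in c₁ without w ≠ e, a condition that passes to tails.
Unique : Word → Set
Unique w = Reduced w × (∀ w' → Reduced w' → w' ≈ w → w' ≡ w)

Unique-tail : Unique (s ∷ w) → Unique w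
Unique-tail {s} {w} (r , uniq) = Reduced-tail r , λ w' rw' w'≈w →
  proj₂ (∷-injective (uniq (s ∷ w') (Reduced-cons rw' (λ d → Reduced⇒¬Desc r (subst (Desc s) (≈⇒φ w'≈w) d))) (≈-cons s w'≈w)))

-- A third letter b contradicts reducedness, and a third letter a admits a braid move to another
-- reduced expression.
Unique⇒spiral : Tri a b c → ∀ m → Unique (a ∷ b ∷ m) → a ∷ b ∷ m ≡ spiral a b c (suc (suc (length m)))
Unique⇒spiral T [] U = refl
Unique⇒spiral {a} {b} {c} T (d ∷ m) U with Tri-cover T d
... | inj₂ (inj₂ refl) = cong (a ∷_) (Unique⇒spiral (rotate T) m (Unique-tail U))
... | inj₂ (inj₁ refl) = ⊥-elim (Reduced⇒¬Desc r' (Reduced⇒Desc (Reduced-tail r')))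
  where
  r' : Reduced (b ∷ b ∷ m)
  r' = proj₁ (Unique-tail U)
... | inj₁ refl = ⊥-elim (Tri⇒≢ T (sym (proj₁ (∷-injective (proj₂ U (b ∷ a ∷ b ∷ m) rbab
    (φ⇒≈ {b ∷ a ∷ b ∷ m} {a ∷ b ∷ a ∷ m} eq))))))
  where
  eq : φ (b ∷ a ∷ b ∷ m) ≡ φ (a ∷ b ∷ a ∷ m)
  eq = sym (act-braid T (φ m))
  rbab : Reduced (b ∷ a ∷ b ∷ m)
  rbab = ℓ⇒Reduced (trans (cong len eq) (Reduced⇒ℓ (proj₁ U)))

cover⇒Tri : ∀ a b c → (∀ σ → σ ≡ a ⊎ σ ≡ b ⊎ σ ≡ c) → Tri a b c
cover⇒Tri a b c cov with a ≟ b
... | no ne with third a b ne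
...   | d , T with cov d
...     | inj₁ refl        = ⊥-elim (Tri⇒≢ (swap₂₃ T) refl)
...     | inj₂ (inj₁ refl) = ⊥-elim (Tri⇒≢ (rotate T) refl)
...     | inj₂ (inj₂ refl) = T
cover⇒Tri a b c cov | yes refl with others a
... | d , e , T = ⊥-elim (Tri⇒≢ (rotate T) (trans (is-c d (λ { refl → Tri⇒≢ T refl }))
    (sym (is-c e (λ { refl → Tri⇒≢ (swap₂₃ T) refl })))))
  where
  is-c : ∀ σ → σ ≢ a → σ ≡ c
  is-c σ ne with cov σ
  ... | inj₁ p        = ⊥-elim (ne p)
  ... | inj₂ (inj₁ p) = ⊥-elim (ne p)
  ... | inj₂ (inj₂ p) = p

card2⇒third : ∀ {A : S → Set} → Tri a b c → HasCard2 A → ¬ A b → A c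
card2⇒third {b = b} {c} {A} T (p , q , p≢q , Ap , Aq , _) ¬b with Tri-cover T p | Tri-cover T q
... | inj₂ (inj₂ refl) | _                = Ap
... | inj₂ (inj₁ refl) | _                = ⊥-elim (¬b Ap)
... | inj₁ _           | inj₂ (inj₂ refl) = Aq
... | inj₁ _           | inj₂ (inj₁ refl) = ⊥-elim (¬b Aq)
... | inj₁ refl        | inj₁ refl        = ⊥-elim (p≢q refl)

third⇒card2 : ∀ {A : S → Set} → Tri a b c → A a → A c → ¬ A b → HasCard2 A
third⇒card2 {a} {b} {c} {A} T Aa Ac ¬b = a , c , Tri⇒≢ (swap₂₃ T) , Aa , Ac , only
  where
  only : ∀ σ → A σ → σ ≡ a ⊎ σ ≡ c
  only σ Aσ with Tri-cover T σ
  ... | inj₁ p           = inj₁ p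
  ... | inj₂ (inj₁ refl) = ⊥-elim (¬b Aσ)
  ... | inj₂ (inj₂ p)    = inj₂ p

-- The descent criterion for spirals

Condition : S → S → S → S → Word → Set
Condition s₁ s₂ sₙ₋₁ sₙ u =
  HasCard2 (InL u) × HasCard2 (InR u) × InL u s₁ × InR u sₙ × ¬ InL u s₂ × ¬ InR u sₙ₋₁

module Main (P : KLFamily) (K : IsKL P) where
  open KL P K
  open Spiral P K

  module _ (T : Tri a b c) (j : ℕ) (u : Word) (C : InC0 u) (eu : ℓ u ≡ suc (suc (suc j)))
           (h : u ≼ spiral a b c (6 ℕ.+ j)) where
    private
      w₀ v₀ z₀ : Word
      w₀ = spiral a b c (6 ℕ.+ j)
      v₀ = spiral b c a (5 ℕ.+ j)
      z₀ = b ∷ spiral a b c (3 ℕ.+ j)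
      TR : Tri (letter a b c j) (letter b c a j) (letter c a b j)
      TR = Tri-letter T j

    -- As u lies in c₀, it is the folded element. Of its two expressions, `e₁` shows the left
    -- descent c and `e₂`, reversed, both right descents; three descents on one side are impossible.
    p₁≢0⇒condition : p u w₀ 1 ≢ 0ℤ → Condition a b (letter b c a j) (letter c a b j) u
    p₁≢0⇒condition ne with p₁≢0 T (3 ℕ.+ j) u h eu ne
    ... | inj₁ e = ⊥-elim (C0⇒¬spiral C T (3 ℕ.+ j) e)
    ... | inj₂ (_ , refl , e₁ , e₂) =
      third⇒card2 T (Desc⇒InL u a da) (Desc⇒InL u c dc) ¬b ,
      third⇒card2 (mirror TR) (Desc⇒InR u _ dz) (Desc⇒InR u _ dx) ¬y ,
      Desc⇒InL u a da , Desc⇒InR u _ dz , ¬b , ¬y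
      where
      da : Desc a (φ u)
      da = p₁≢0⇒Desc T (3 ℕ.+ j) u h eu ne
      dc : Desc c (φ u)
      dc = subst (Desc c) (sym e₁) (spiral-prefix-second (rotate (rotate T)) j)
      ¬b : ¬ InL u b
      ¬b i = no-three-descents (swap₂₃ T) (φ-isAlcove u) da dc (InL⇒Desc u b i)
      φū : φ (reverse u) ≡ φ (letter c a b j ∷ spiral (letter a b c j) (letter c a b j) (letter b c a j) (suc (suc j)))
      φū = trans (φ-reverse {u} {spiral c a b (suc (suc j)) ++ letter c a b j ∷ []} e₂)
             (cong φ (trans (reverse-snoc (spiral c a b (suc (suc j))) (letter c a b j))
               (cong (letter c a b j ∷_) (reverse-spiral c a b (suc (suc j))))))
      dz : Desc (letter c a b j) (φ (reverse u))
      dz = subst (Desc (letter c a b j)) (sym φū) (Desc-act (letter c a b j) (spiral-¬second (swap₂₃ TR) (suc (suc j))))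
      dx : Desc (letter a b c j) (φ (reverse u))
      dx = subst (Desc (letter a b c j)) (sym φū) (spiral-prefix-second (swap₂₃ TR) j)
      ¬y : ¬ InR u (letter b c a j)
      ¬y i = no-three-descents (swap₂₃ TR) (φ-isAlcove (reverse u)) dx dz (InR⇒Desc u _ i)

    -- The three terms of `p₁-spiral` are 0, 1 and 0: b is no descent of au, so P_{au,v} reduces to
    -- colength two; u is a subword of cab⋯ by `fold-end`; and u ≤ z₀ would make u the spiral abc⋯,
    -- which has no descent c.
    condition⇒p₁≡1 : Condition a b (letter b c a j) (letter c a b j) u → p u w₀ 1 ≡ 1ℤ
    condition⇒p₁≡1 (card-L , card-R , a∈L , z∈R , b∉L , y∉R) =
      trans (p₁-spiral T (suc j) u h da) 
        (trans (cong₂ (λ i k → (i ℤ.+ k) ℤ.- p u z₀ 0) pa (p₀ rv₀ hv))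
        (cong (λ i → 1ℤ ℤ.- i) (p-vanish (z₀-reduced T (suc j)) ¬hz 0)))
      where
      rv₀ : Reduced v₀
      rv₀ = spiral-reduced (rotate T) _
      da : Desc a (φ u)
      da = InL⇒Desc u a a∈L
      dc : Desc c (φ u)
      dc = InL⇒Desc u c (card2⇒third T card-L b∉L)
      φu : φ u ≡ φ (spiral c a b (suc (suc j)) ++ letter c a b j ∷ [])
      φu = fold-end T j u h eu da dc (InR⇒Desc u _ (card2⇒third (mirror TR) card-R y∉R)) (InR⇒Desc u _ z∈R)
      end⊆ : spiral c a b (suc (suc j)) ++ letter c a b j ∷ [] ⊆ spiral c a b (4 ℕ.+ j)
      end⊆ = subst (spiral c a b (suc (suc j)) ++ letter c a b j ∷ [] ⊆_)
               (trans (sym (spiral-++ c a b (suc (suc j)) 2)) (cong (spiral c a b) (ℕ.+-comm (suc (suc j)) 2)))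
               (++⁺ (⊆-refl {x = spiral c a b (suc (suc j))}) (letter b c a j ∷ʳ refl ∷ []))
      hv : u ≼ v₀
      hv = ≼-step b (≼-respˡ {spiral c a b (suc (suc j)) ++ letter c a b j ∷ []} (sym φu) (⊆⇒≼ end⊆))
      ¬hz : ¬ (u ≼ z₀)
      ¬hz q = spiral-¬third T (3 ℕ.+ j) (subst (Desc c)
        (spiral-antisym a b c (3 ℕ.+ j) (≼-up b u q (λ d → b∉L (Desc⇒InL u b d))) eu) dc)
      le : length (spiral c a b (4 ℕ.+ j)) ≤ suc (suc (ℓ (a ∷ u)))
      le = ℕ.≤-reflexive (trans (length-spiral c a b _) (cong (λ k → suc (suc k)) (sym (ℓ-desc a u da eu))))
      pa : p (a ∷ u) v₀ 1 ≡ 0ℤ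
      pa = trans (p₁-up {x = a ∷ u} rv₀ (≼-down a u h da) (no-third-descent (swap₂₃ T) dc) le)
                 (p₁-colength≤2 {x = a ∷ u} (Reduced-tail rv₀) le)

μ-colength-3 : ∀ P u w → length w ≡ length u ℕ.+ 3 → μ P u w ≡ P u w 1
μ-colength-3 P u w e rewrite e | ℕ.m+n∸m≡n (length u) 3 = refl

theorem5p12 : (P : KLFamily) → IsKL P →
    (w : Word) (s₁ s₂ s₃ sₙ₋₁ sₙ : S) (m m' : Word) →
    w ≡ s₁ ∷ s₂ ∷ s₃ ∷ m → w ≡ m' ++ sₙ₋₁ ∷ sₙ ∷ [] →
    InC1 w → (∀ σ → σ ≡ s₁ ⊎ σ ≡ s₂ ⊎ σ ≡ s₃) →
    (u : Word) → InC0w3 w u →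
    ((μ P u w ≢ 0ℤ) ⇔ (HasCard2 (InL u) × HasCard2 (InR u) × InL u s₁ × InR u sₙ × ¬ InL u s₂ × ¬ InR u sₙ₋₁))
    × ((HasCard2 (InL u) × HasCard2 (InR u) × InL u s₁ × InR u sₙ × ¬ InL u s₂ × ¬ InR u sₙ₋₁) → μ P u w ≡ 1ℤ)
theorem5p12 P K w a b c sₙ₋₁ sₙ m m' refl w≡ (rw , _ , uniq) cov u (C , (u≤w , _) , len≡)
  with C0-length C
... | j , lu = conclude ends
  where
  open KL P K
  open Main P K
  T : Tri a b c
  T = cover⇒Tri a b c cov
  n : ℕ
  n = suc (5 ℕ.+ j)
  lw : length w ≡ n
  lw = trans len≡ (trans (ℕ.+-comm (length u) 3) (cong (λ k → suc (suc (suc k))) lu))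
  w≡spiral : w ≡ spiral a b c n
  w≡spiral = trans (Unique⇒spiral T (c ∷ m) (rw , uniq)) (cong (spiral a b c) lw)
  -- Both letters are read off the reversed spiral; its length 6 + j may be replaced by j because
  -- the letters have period three.
  ends : sₙ ≡ letter c a b j × sₙ₋₁ ≡ letter b c a j
  ends with trans (sym (reverse-++ m' (sₙ₋₁ ∷ sₙ ∷ []))) (trans (cong reverse (trans (sym w≡) w≡spiral)) (reverse-spiral a b c n))
  ... | e = proj₁ (∷-injective e) , proj₁ (∷-injective (proj₂ (∷-injective e)))
  eu : ℓ u ≡ suc (suc (suc j))
  eu = trans (Reduced⇒ℓ (proj₁ C)) lu
  h : u ≼ spiral a b c n
  h = subst (u ≼_) w≡spiral (≤B⇒≼ rw u≤w)
  μ≡p₁ : μ P u w ≡ p u (spiral a b c n) 1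
  μ≡p₁ = trans (μ-colength-3 P u w len≡) (trans (P≡p (proj₁ C) rw 1) (cong (λ q → p u q 1) w≡spiral))
  conclude : sₙ ≡ letter c a b j × sₙ₋₁ ≡ letter b c a j →
             ((μ P u w ≢ 0ℤ) ⇔ Condition a b sₙ₋₁ sₙ u) × (Condition a b sₙ₋₁ sₙ u → μ P u w ≡ 1ℤ)
  conclude (refl , refl) =
    mk⇔ (λ ne → p₁≢0⇒condition T j u C eu h (λ e → ne (trans μ≡p₁ e)))
        (λ cond e → 1≢0 (trans (sym (one cond)) e)) , one
    where
    one : Condition a b (letter b c a j) (letter c a b j) u → μ P u w ≡ 1ℤ
    one cond = trans μ≡p₁ (condition⇒p₁≡1 T j u C eu h cond)
    1≢0 : 1ℤ ≢ 0ℤ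
    1≢0 ()
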